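{- Let $k,m$ be positive integers with $m\ge 5$ and let $b\in\{0,2,4,\ldots\}$. If $b\equiv 0\pmod 4$, then $$E_{k\varphi(5^m)+b}-(1-5^b)E_b\equiv 5^{m-1}k(3130-4000b+3375b^2+3125b^3-3125b^4)\pmod{5^{m+5}}.$$ If $b\equiv 2\pmod 4$, then $$E_{k\varphi(5^m)+b}-(1-5^b)E_b\equiv 5^{m-1}k(4790+1750b^2+3125b^3+6250b^4)\pmod{5^{m+5}}.$$
   Context: The Euler numbers $\{E_n\}_{n\ge0}$ are the integers defined by $E_0=1$, $E_{2n-1}=0$ and $\sum_{r=0}^n\binom{2n}{2r}E_{2r}=0$ for $n=1,2,3,\ldots$. $\varphi$ denotes Euler's totient function. -}

module Defs where

open import Data.Fin.Base using (Fin; zero; suc; toℕ; fromℕ; inject₁; opposite)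
open import Data.Fin.Properties using (toℕ-inject₁; toℕ-fromℕ; opposite-prop; opposite-involutive)
open import Data.Integer.Base using (ℤ; +_; -_; _+_; _-_; _*_; 0ℤ; 1ℤ)
open import Data.Integer.Divisibility using (_∣_)
open import Data.Integer.Properties using (+-0-monoid; *-identityˡ; +-inverseʳ)
open import Data.List.Base using (length; filter; upTo; map)
open import Data.Nat.Base as ℕ using (ℕ; zero; suc; parity; ⌊_/2⌋)
open import Data.Nat.Combinatorics using (_C_; nCn≡1)
open import Data.Nat.Coprimality using (coprime?)
import Data.Nat.Properties as ℕ
open import Data.Parity.Base using (0ℙ; 1ℙ)
open import Data.Vec.Functional using (Vector; []; _∷_)
open import Relation.Binary.PropositionalEquality
open import Algebra.Properties.Monoid.Sum +-0-monoid public
  using (sum-syntax; sum⁺-syntax)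
open import Algebra.Properties.Monoid.Sum +-0-monoid
  using (sum-cong-≗; sum-init-last)

infix 4 _≡_[mod_]

_≡_[mod_] : ℤ → ℤ → ℕ → Set
a ≡ b [mod n ] = + n ∣ a - b

φ : ℕ → ℕ
φ n = length (filter (λ i → coprime? i n) (map suc (upTo n)))

record IsEulerSequence (E : ℕ → ℤ) : Set where
  field
    E₀    : E 0 ≡ 1ℤ
    E-odd : ∀ n → 1 ℕ.≤ n → E (2 ℕ.* n ℕ.∸ 1) ≡ 0ℤ
    E-sum : ∀ n → 1 ℕ.≤ n →
            ∑[ r ≤ n ] (+ ((2 ℕ.* n) C (2 ℕ.* toℕ r)) * E (2 ℕ.* toℕ r)) ≡ 0ℤ

-- The recurrence solved for its top term E₂ₙ, whose coefficient is 1. The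
-- vector holds E₀, E₂, …, E₂ₙ₋₂ in reverse order, most recent value first.
nextEven : ∀ n → Vector ℤ n → ℤ
nextEven zero      _ = 1ℤ
nextEven n@(suc _) v =
  - (∑[ r < n ] (+ ((2 ℕ.* n) C (2 ℕ.* toℕ r)) * v (opposite r)))

evens : ∀ n → Vector ℤ n
evens zero    = []
evens (suc n) = nextEven n (evens n) ∷ evens n

E : ℕ → ℤ
E n with parity n
... | 0ℙ = nextEven ⌊ n /2⌋ (evens ⌊ n /2⌋)
... | 1ℙ = 0ℤ

private
  half-2* : ∀ n → ⌊ 2 ℕ.* n /2⌋ ≡ n
  half-2* n = trans (cong (λ k → ⌊ n ℕ.+ k /2⌋) (ℕ.+-identityʳ n))
                    (sym (ℕ.n≡⌊n+n/2⌋ n))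

  parity-2* : ∀ n → parity (2 ℕ.* n) ≡ 0ℙ
  parity-2* zero    = refl
  parity-2* (suc n) = trans (cong parity (ℕ.*-suc 2 n)) (parity-2* n)

  parity-odd : ∀ n → parity (suc (2 ℕ.* n)) ≡ 1ℙ
  parity-odd zero    = refl
  parity-odd (suc n) = trans (cong (λ k → parity (suc k)) (ℕ.*-suc 2 n)) (parity-odd n)

  E-2* : ∀ n → E (2 ℕ.* n) ≡ nextEven n (evens n)
  E-2* n with parity (2 ℕ.* n) | parity-2* n
  ... | .0ℙ | refl = cong (λ k → nextEven k (evens k)) (half-2* n)

  E-suc2* : ∀ n → E (suc (2 ℕ.* n)) ≡ 0ℤ
  E-suc2* n with parity (suc (2 ℕ.* n)) | parity-odd n
  ... | .1ℙ | refl = refl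

  evens≡ : ∀ n (i : Fin n) → evens n i ≡ E (2 ℕ.* (n ℕ.∸ suc (toℕ i)))
  evens≡ (suc n) zero    = sym (E-2* n)
  evens≡ (suc n) (suc i) = evens≡ n i

  evens-opposite : ∀ n (r : Fin n) → evens n (opposite r) ≡ E (2 ℕ.* toℕ r)
  evens-opposite n r = trans (evens≡ n (opposite r)) (cong (λ k → E (2 ℕ.* k))
    (trans (sym (opposite-prop (opposite r))) (cong toℕ (opposite-involutive r))))

  recurrence : ∀ n → ∑[ r ≤ suc n ]
    (+ ((2 ℕ.* suc n) C (2 ℕ.* toℕ r)) * E (2 ℕ.* toℕ r)) ≡ 0ℤ
  recurrence n = begin
    ∑[ r < suc N ] f (toℕ r)             ≡⟨ sum-init-last {N} (λ r → f (toℕ r)) ⟩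
    ∑[ r < N ] f (toℕ (inject₁ r)) + f (toℕ (fromℕ N))
      ≡⟨ cong₂ _+_ (sum-cong-≗ {N} λ r → cong f (toℕ-inject₁ r)) (cong f (toℕ-fromℕ N)) ⟩
    ∑[ r < N ] f (toℕ r) + f N           ≡⟨ cong (_+_ S) top ⟩
    S + - S                              ≡⟨ +-inverseʳ S ⟩
    0ℤ                                   ∎
    where
    open ≡-Reasoning
    N : ℕ
    N = suc n
    f : ℕ → ℤ
    f r = + ((2 ℕ.* N) C (2 ℕ.* r)) * E (2 ℕ.* r)
    S : ℤ
    S = ∑[ r < N ] f (toℕ r)
    top : f N ≡ - S
    top = begin
      + ((2 ℕ.* N) C (2 ℕ.* N)) * E (2 ℕ.* N)
        ≡⟨ cong (λ c → + c * E (2 ℕ.* N)) (nCn≡1 (2 ℕ.* N)) ⟩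
      1ℤ * E (2 ℕ.* N)                   ≡⟨ *-identityˡ _ ⟩
      E (2 ℕ.* N)                        ≡⟨ E-2* N ⟩
      nextEven N (evens N)
        ≡⟨ cong -_ (sum-cong-≗ {N} λ r →
             cong (_*_ (+ ((2 ℕ.* N) C (2 ℕ.* toℕ r)))) (evens-opposite N r)) ⟩
      - S                                ∎

E-isEulerSequence : IsEulerSequence E
E-isEulerSequence = record
  { E₀    = refl
  ; E-odd = λ { (suc n) _ → trans (cong (λ k → E (k ℕ.∸ 1)) (ℕ.*-suc 2 n)) (E-suc2* n) }
  ; E-sum = λ { (suc n) _ → recurrence n }
  }

{-# OPTIONS --safe #-}

-- Let the sequences ℕ → ℤ be a ℤ[X]-module with X acting as the shift. The Euler numbers are
-- characterised by ((X + 1)ⁿ + (X - 1)ⁿ) E = 0 at 0 for n > 0 and E₀ = 1; uniqueness yields the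
-- distribution relation Eₙ = Σ_{|c| ≤ 2} (-1)^c ((5X + 2c)ⁿ E)(0), whose term c = 0 is 5ⁿ Eₙ.
-- For c ≠ 0 the operator (5X + 2c)⁴ - 1 is divisible by 5, so the r-th difference of
-- E′(t) = (1 - 5ⁿ) Eₙ, n = 4t + b, is divisible by 5ʳ. Hence in Newton's expansion of
-- E′(K + t) - E′(t), K = k 5ᵐ⁻¹, only the terms of order ≤ 5 survive mod 5ᵐ⁺⁵, and these add up to
-- K log(1 + Δ) E′(t); the value of log(1 + Δ) E′(t) mod 5⁶ is a polynomial in t fixed by
-- E₀, …, E₂₆.
module Submission where

open import Data.Fin using (Fin; toℕ; #_)
open import Data.Fin.Properties using (all?)
open import Data.Integer using (ℤ; +_; -_; _+_; _-_; _*_; _^_; 0ℤ; 1ℤ; -1ℤ; ∣_∣)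
import Data.Integer.Properties as ℤ
open import Data.Integer.Divisibility.Signed as S using (divides; _∣?_)
open import Data.Integer.Tactic.RingSolver using (solve-∀)
open import Data.List.Base using (length; filter; upTo; applyUpTo; map)
import Data.List.Properties as List
open import Data.Nat as ℕ using (ℕ; zero; suc; _≤_; _<_; z≤n; s≤s)
open import Data.Nat.Combinatorics using (_C_; nCk+nC[k+1]≡[n+1]C[k+1])
open import Data.Nat.Coprimality using (Coprime; coprime?; coprime-divisor)
open import Data.Nat.Divisibility using (_∣_)
import Data.Nat.Divisibility as ℕ
open import Data.Nat.Induction using (<-rec)
open import Data.Nat.Primality using (Prime; prime?; euclidsLemma; prime⇒irreducible)
import Data.Nat.Properties as ℕ
open import Data.Product using (_×_; _,_; ∃)
open import Data.Sum.Base using (_⊎_; inj₁; inj₂)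
open import Function.Base using (_∘_; id)
open import Level using (0ℓ)
open import Relation.Binary.PropositionalEquality
open import Relation.Nullary using (¬_; contradiction)
open import Relation.Nullary.Decidable using (True; toWitness; from-yes; from-no)
open import Relation.Unary using (Pred; Decidable)
open import Defs

-- The distribution relation comes from (eᵘ + e⁻ᵘ) Σ (-1)ᶜ e²ᶜᵘ = e⁵ᵘ + e⁻⁵ᵘ, summed over |c| ≤ 2,
-- since 2/(eᵘ + e⁻ᵘ) generates the Euler numbers. The step 4 of the progression is forced by φ(5ᵐ)
-- = 4·5ᵐ⁻¹ and by c⁴ ≡ 1 mod 5; this is why b mod 4 separates two cases, each with its own
-- polynomial. The precision is a budget. As 5ᵐ⁻¹ divides K, the r-th term C(K, r) Δʳ is divisible
-- by 5 to the power m - 1 + r - v₅(r). This reaches m + 5 for every r ≥ 6, but at r = 5 it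
-- guarantees only m + 3, so order 5 has to stay. For r ≤ 5 the C(K, r) are polynomials in K whose
-- denominators divide 120, with linear part (-1)ʳ⁻¹ K/r: hence the logarithm. Multiplying by 120 =
-- 5·24 keeps everything integral at the price of one factor 5, so the logarithm is handled mod 5⁷
-- after scaling. The terms of higher degree in K then amount to K² times a multiple of 5³, which is
-- negligible mod 5ᵐ⁺⁶ exactly because m ≥ 5.

Seq : Set
Seq = ℕ → ℤ

-- Sequences form a module over ℤ[X], with X acting as the shift; W a c s n i
-- is the entry at i of (aX + c)ⁿ s.
W : ℤ → ℤ → Seq → ℕ → Seq
W a c s zero    i = s i
W a c s (suc n) i = a * W a c s n (suc i) + c * W a c s n i

Σ< : ℕ → Seq → ℤ
Σ< B h = ∑[ j < B ] h (toℕ j)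

-- Linear operators aX + c: linearity, substitution, scaling

-- The bound on j matters: the tables `e₀` and `e₂` agree with the Euler numbers only for small
-- indices.
W-cong≤ : ∀ a c {u v : Seq} n i → (∀ j → j ≤ n ℕ.+ i → u j ≡ v j) → W a c u n i ≡ W a c v n i
W-cong≤ a c zero    i eq = eq i ℕ.≤-refl
W-cong≤ a c (suc n) i eq = cong₂ (λ x y → a * x + c * y)
  (W-cong≤ a c n (suc i) λ j le → eq j (subst (j ≤_) (ℕ.+-suc n i) le))
  (W-cong≤ a c n i λ j le → eq j (ℕ.m≤n⇒m≤1+n le))

W-+ : ∀ a c u v n i → W a c (λ j → u j + v j) n i ≡ W a c u n i + W a c v n i
W-+ a c u v zero    i = refl
W-+ a c u v (suc n) i
  rewrite W-+ a c u v n i | W-+ a c u v n (suc i)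
  = lemma a c (W a c u n (suc i)) (W a c v n (suc i)) (W a c u n i) (W a c v n i)
  where
  lemma : ∀ a c p q x y → a * (p + q) + c * (x + y) ≡ a * p + c * x + (a * q + c * y)
  lemma = solve-∀

W-- : ∀ a c u v n i → W a c (λ j → u j - v j) n i ≡ W a c u n i - W a c v n i
W-- a c u v zero    i = refl
W-- a c u v (suc n) i
  rewrite W-- a c u v n i | W-- a c u v n (suc i)
  = lemma a c (W a c u n (suc i)) (W a c v n (suc i)) (W a c u n i) (W a c v n i)
  where
  lemma : ∀ a c p q x y → a * (p - q) + c * (x - y) ≡ a * p + c * x - (a * q + c * y)
  lemma = solve-∀

W-lin : ∀ a d b c u n i →
  W a d (λ j → b * u (suc j) + c * u j) n i ≡ b * W a d u n (suc i) + c * W a d u n i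
W-lin a d b c u zero    i = refl
W-lin a d b c u (suc n) i
  rewrite W-lin a d b c u n i | W-lin a d b c u n (suc i)
  = lemma a b c d (W a d u n i) (W a d u n (suc i)) (W a d u n (suc (suc i)))
  where
  lemma : ∀ a b c d x y z →
    a * (b * z + c * y) + d * (b * y + c * x) ≡ b * (a * z + d * y) + c * (a * y + d * x)
  lemma = solve-∀

-- Substituting aX + c for X turns X + e into aX + (c + e).
W-substitute : ∀ a c e s n j i →
  W 1ℤ e (λ k → W a c s k i) n j ≡ W a (c + e) (W a c s j) n i
W-substitute a c e s zero    j i = refl
W-substitute a c e s (suc n) j i = begin
  1ℤ * W 1ℤ e (λ k → W a c s k i) n (suc j) + e * W 1ℤ e (λ k → W a c s k i) n j
    ≡⟨ cong₂ (λ x y → 1ℤ * x + e * y) (W-substitute a c e s n (suc j) i) (W-substitute a c e s n j i) ⟩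
  1ℤ * W a (c + e) (W a c s (suc j)) n i + e * W a (c + e) (W a c s j) n i
    ≡⟨ cong (λ x → 1ℤ * x + e * W a (c + e) (W a c s j) n i) (W-lin a (c + e) a c (W a c s j) n i) ⟩
  1ℤ * (a * W a (c + e) (W a c s j) n (suc i) + c * W a (c + e) (W a c s j) n i)
    + e * W a (c + e) (W a c s j) n i
    ≡⟨ lemma a c e _ _ ⟩
  a * W a (c + e) (W a c s j) n (suc i) + (c + e) * W a (c + e) (W a c s j) n i ∎
  where
  open ≡-Reasoning
  lemma : ∀ a c e x y → 1ℤ * (a * x + c * y) + e * y ≡ a * x + (c + e) * y
  lemma = solve-∀

W-monomial : ∀ a s n i → W a 0ℤ s n i ≡ a ^ n * s (n ℕ.+ i)
W-monomial a s zero    i = sym (ℤ.*-identityˡ _)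
W-monomial a s (suc n) i
  rewrite W-monomial a s n (suc i) | ℕ.+-suc n i
  = lemma a (a ^ n) (s (suc (n ℕ.+ i))) (W a 0ℤ s n i)
  where
  lemma : ∀ a p x y → a * (p * x) + 0ℤ * y ≡ a * p * x
  lemma = solve-∀

W-scale : ∀ a e s n i → W a (a * e) s n i ≡ a ^ n * W 1ℤ e s n i
W-scale a e s zero    i = sym (ℤ.*-identityˡ _)
W-scale a e s (suc n) i
  rewrite W-scale a e s n i | W-scale a e s n (suc i)
  = lemma a e (a ^ n) (W 1ℤ e s n i) (W 1ℤ e s n (suc i))
  where
  lemma : ∀ a e p x y → a * (p * y) + a * e * (p * x) ≡ a * p * (1ℤ * y + e * x)
  lemma = solve-∀

-- Xⁿ enters (X + e)ⁿ with coefficient 1, and every lower power of X meets a zero of `s`.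
W-leading : ∀ e s N → (∀ j → j < N → s j ≡ 0ℤ) →
  ∀ n i → n ℕ.+ i ≤ N → W 1ℤ e s n i ≡ s (n ℕ.+ i)
W-leading e s N s≡0 zero    i _ = refl
W-leading e s N s≡0 (suc n) i le
  rewrite W-leading e s N s≡0 n (suc i) (subst (_≤ N) (sym (ℕ.+-suc n i)) le)
        | W-leading e s N s≡0 n i (ℕ.<⇒≤ le)
        | s≡0 (n ℕ.+ i) le
        | ℕ.+-suc n i
  = lemma e (s (suc (n ℕ.+ i)))
  where
  lemma : ∀ e x → 1ℤ * x + e * 0ℤ ≡ x
  lemma = solve-∀

-- Finite sums and the binomial expansion of (X + 1)ⁿ

Σ<-cong : ∀ B {h k : Seq} → (∀ j → h j ≡ k j) → Σ< B h ≡ Σ< B k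
Σ<-cong zero    eq = refl
Σ<-cong (suc B) eq = cong₂ _+_ (eq 0) (Σ<-cong B λ j → eq (suc j))

Σ<-zero : ∀ B {h : Seq} → (∀ j → h j ≡ 0ℤ) → Σ< B h ≡ 0ℤ
Σ<-zero zero    eq = refl
Σ<-zero (suc B) eq = cong₂ _+_ (eq 0) (Σ<-zero B λ j → eq (suc j))

Σ<-+ : ∀ B (h k : Seq) → Σ< B (λ j → h j + k j) ≡ Σ< B h + Σ< B k
Σ<-+ zero    h k = refl
Σ<-+ (suc B) h k
  rewrite Σ<-+ B (λ j → h (suc j)) (λ j → k (suc j))
  = lemma (h 0) (k 0) (Σ< B (λ j → h (suc j))) (Σ< B (λ j → k (suc j)))
  where
  lemma : ∀ x y p q → x + y + (p + q) ≡ x + p + (y + q)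
  lemma = solve-∀

Σ<-evens : ∀ m (h : Seq) → (∀ r → h (suc (2 ℕ.* r)) ≡ 0ℤ) →
  Σ< (suc (2 ℕ.* m)) h ≡ Σ< (suc m) (λ r → h (2 ℕ.* r))
Σ<-evens zero    h odd = refl
Σ<-evens (suc m) h odd
  rewrite ℕ.+-suc m (m ℕ.+ 0) | odd 0 | ℤ.+-identityˡ (Σ< (suc (2 ℕ.* m)) (λ j → h (suc (suc j))))
  = cong (_+_ (h 0)) (trans
      (Σ<-evens m (λ j → h (suc (suc j)))
        (λ r → trans (cong (λ x → h (suc x)) (sym (ℕ.*-suc 2 r))) (odd (suc r))))
      (Σ<-cong (suc m) λ r → cong h (sym (ℕ.*-suc 2 r))))

Σ<-pascal : ∀ B n (h : Seq) →
  Σ< (suc B) (λ j → + (suc n C j) * h j)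
  ≡ Σ< B (λ j → + (n C j) * h (suc j)) + Σ< (suc B) (λ j → + (n C j) * h j)
Σ<-pascal B n h = begin
  1ℤ * h 0 + Σ< B (λ j → + (suc n C suc j) * h (suc j))
    ≡⟨ cong (_+_ (1ℤ * h 0)) (Σ<-cong B λ j → begin
         + (suc n C suc j) * h (suc j)
           ≡⟨ cong (λ c → + c * h (suc j)) (nCk+nC[k+1]≡[n+1]C[k+1] n j) ⟨
         (+ (n C j) + + (n C suc j)) * h (suc j)
           ≡⟨ ℤ.*-distribʳ-+ (h (suc j)) (+ (n C j)) (+ (n C suc j)) ⟩
         + (n C j) * h (suc j) + + (n C suc j) * h (suc j) ∎) ⟩
  1ℤ * h 0 + Σ< B (λ j → + (n C j) * h (suc j) + + (n C suc j) * h (suc j))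
    ≡⟨ cong (_+_ (1ℤ * h 0)) (Σ<-+ B (λ j → + (n C j) * h (suc j)) (λ j → + (n C suc j) * h (suc j))) ⟩
  1ℤ * h 0 + (Σ< B (λ j → + (n C j) * h (suc j)) + Σ< B (λ j → + (n C suc j) * h (suc j)))
    ≡⟨ lemma (1ℤ * h 0) (Σ< B λ j → + (n C j) * h (suc j)) (Σ< B λ j → + (n C suc j) * h (suc j)) ⟩
  Σ< B (λ j → + (n C j) * h (suc j)) + Σ< (suc B) (λ j → + (n C j) * h j) ∎
  where
  open ≡-Reasoning
  lemma : ∀ x y z → x + (y + z) ≡ y + (x + z)
  lemma = solve-∀

-- Terms with j > n vanish, so the bound is free: the induction uses `B` and `suc B` side by side,
-- and Newton's expansion later takes a bound of the form p + (n + 1) in order to split off the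
-- first p terms.
W-binomial : ∀ s n B i → n < B → W 1ℤ 1ℤ s n i ≡ Σ< B (λ j → + (n C j) * s (i ℕ.+ j))
W-binomial s zero    (suc B) i _ = begin
  s i                                ≡⟨ cong s (ℕ.+-identityʳ i) ⟨
  s (i ℕ.+ 0)                        ≡⟨ lemma (s (i ℕ.+ 0)) ⟩
  1ℤ * s (i ℕ.+ 0) + 0ℤ              ≡⟨ cong (_+_ (1ℤ * s (i ℕ.+ 0))) (Σ<-zero B λ j → refl) ⟨
  Σ< (suc B) (λ j → + (0 C j) * s (i ℕ.+ j)) ∎
  where
  open ≡-Reasoning
  lemma : ∀ x → x ≡ 1ℤ * x + 0ℤ
  lemma = solve-∀
W-binomial s (suc n) (suc B) i (s≤s n<B) = begin
  1ℤ * W 1ℤ 1ℤ s n (suc i) + 1ℤ * W 1ℤ 1ℤ s n i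
    ≡⟨ cong₂ _+_ (ℤ.*-identityˡ (W 1ℤ 1ℤ s n (suc i))) (ℤ.*-identityˡ (W 1ℤ 1ℤ s n i)) ⟩
  W 1ℤ 1ℤ s n (suc i) + W 1ℤ 1ℤ s n i
    ≡⟨ cong₂ _+_ (W-binomial s n B (suc i) n<B) (W-binomial s n (suc B) i (ℕ.m≤n⇒m≤1+n n<B)) ⟩
  Σ< B (λ j → + (n C j) * s (suc i ℕ.+ j)) + Σ< (suc B) (λ j → + (n C j) * s (i ℕ.+ j))
    ≡⟨ cong (λ x → x + Σ< (suc B) (λ j → + (n C j) * s (i ℕ.+ j)))
         (Σ<-cong B λ j → cong (λ k → + (n C j) * s k) (sym (ℕ.+-suc i j))) ⟩
  Σ< B (λ j → + (n C j) * s (i ℕ.+ suc j)) + Σ< (suc B) (λ j → + (n C j) * s (i ℕ.+ j))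
    ≡⟨ Σ<-pascal B n (λ j → s (i ℕ.+ j)) ⟨
  Σ< (suc B) (λ j → + (suc n C j) * s (i ℕ.+ j)) ∎
  where open ≡-Reasoning

-- The functional equation of the Euler numbers and its uniqueness

even⊎odd : ∀ n → (∃ λ m → n ≡ 2 ℕ.* m) ⊎ (∃ λ m → n ≡ suc (2 ℕ.* m))
even⊎odd zero = inj₁ (0 , refl)
even⊎odd (suc n) with even⊎odd n
... | inj₁ (m , refl) = inj₂ (m , refl)
... | inj₂ (m , refl) = inj₁ (suc m , sym (ℕ.*-suc 2 m))

-1^even : ∀ m → -1ℤ ^ (2 ℕ.* m) ≡ 1ℤ
-1^even zero    = refl
-1^even (suc m) = trans (cong (-1ℤ ^_) (ℕ.*-suc 2 m)) (cong (λ x → -1ℤ * (-1ℤ * x)) (-1^even m))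

-1^odd : ∀ m → -1ℤ ^ (suc (2 ℕ.* m)) ≡ -1ℤ
-1^odd m = cong (-1ℤ *_) (-1^even m)

E-odd : ∀ m → E (suc (2 ℕ.* m)) ≡ 0ℤ
E-odd m = trans (cong (λ k → E (k ℕ.∸ 1)) (sym (ℕ.*-suc 2 m)))
                (IsEulerSequence.E-odd E-isEulerSequence (suc m) (s≤s z≤n))

-- Multiplication by (-1)ⁱ fixes `s` and conjugates X into -X, hence X - 1 into -(X + 1).
W-reflect : ∀ s → (∀ i → s i ≡ -1ℤ ^ i * s i) →
  ∀ n i → W 1ℤ -1ℤ s n i ≡ -1ℤ ^ (n ℕ.+ i) * W 1ℤ 1ℤ s n i
W-reflect s s-even zero    i = s-even i
W-reflect s s-even (suc n) i
  rewrite W-reflect s s-even n i | W-reflect s s-even n (suc i) | ℕ.+-suc n i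
  = lemma (-1ℤ ^ (n ℕ.+ i)) (W 1ℤ 1ℤ s n i) (W 1ℤ 1ℤ s n (suc i))
  where
  lemma : ∀ p x y → 1ℤ * (-1ℤ * p * y) + -1ℤ * (p * x) ≡ -1ℤ * p * (1ℤ * y + 1ℤ * x)
  lemma = solve-∀

E-reflect : ∀ i → E i ≡ -1ℤ ^ i * E i
E-reflect i with even⊎odd i
... | inj₁ (m , refl) = sym (trans (cong (_* E (2 ℕ.* m)) (-1^even m)) (ℤ.*-identityˡ (E (2 ℕ.* m))))
... | inj₂ (m , refl) = trans (E-odd m) (sym (trans
        (cong (-1ℤ ^ suc (2 ℕ.* m) *_) (E-odd m)) (ℤ.*-zeroʳ (-1ℤ ^ suc (2 ℕ.* m)))))

W-E-even : ∀ m → W 1ℤ 1ℤ E (2 ℕ.* suc m) 0 ≡ 0ℤ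
W-E-even m = begin
  W 1ℤ 1ℤ E (2 ℕ.* suc m) 0
    ≡⟨ W-binomial E (2 ℕ.* suc m) (suc (2 ℕ.* suc m)) 0 (ℕ.n<1+n (2 ℕ.* suc m)) ⟩
  Σ< (suc (2 ℕ.* suc m)) (λ j → + ((2 ℕ.* suc m) C j) * E j)
    ≡⟨ Σ<-evens (suc m) (λ j → + ((2 ℕ.* suc m) C j) * E j) (λ r →
         trans (cong (_*_ (+ ((2 ℕ.* suc m) C suc (2 ℕ.* r)))) (E-odd r))
               (ℤ.*-zeroʳ (+ ((2 ℕ.* suc m) C suc (2 ℕ.* r))))) ⟩
  Σ< (suc (suc m)) (λ r → + ((2 ℕ.* suc m) C (2 ℕ.* r)) * E (2 ℕ.* r))
    ≡⟨ IsEulerSequence.E-sum E-isEulerSequence (suc m) (s≤s z≤n) ⟩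
  0ℤ ∎
  where open ≡-Reasoning

-- The generating-function identity (eᵗ + e⁻ᵗ) Σ Eₙtⁿ/n! = 2, coefficientwise and at n > 0.
E-functional : ∀ n → W 1ℤ 1ℤ E (suc n) 0 + W 1ℤ -1ℤ E (suc n) 0 ≡ 0ℤ
E-functional n = trans
  (cong (_+_ (W 1ℤ 1ℤ E (suc n) 0)) (trans (W-reflect E E-reflect (suc n) 0)
    (cong (λ k → -1ℤ ^ k * W 1ℤ 1ℤ E (suc n) 0) (ℕ.+-identityʳ (suc n)))))
  (cases (even⊎odd (suc n)))
  where
  cancel : ∀ x → x + -1ℤ * x ≡ 0ℤ
  cancel = solve-∀
  cases : (∃ λ m → suc n ≡ 2 ℕ.* m) ⊎ (∃ λ m → suc n ≡ suc (2 ℕ.* m)) →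
    W 1ℤ 1ℤ E (suc n) 0 + -1ℤ ^ suc n * W 1ℤ 1ℤ E (suc n) 0 ≡ 0ℤ
  cases (inj₁ (suc m , eq)) = trans
    (cong₂ (λ x y → x + -1ℤ ^ suc n * y) zero-at zero-at)
    (trans (ℤ.+-identityˡ (-1ℤ ^ suc n * 0ℤ)) (ℤ.*-zeroʳ (-1ℤ ^ suc n)))
    where
    zero-at : W 1ℤ 1ℤ E (suc n) 0 ≡ 0ℤ
    zero-at = trans (cong (λ k → W 1ℤ 1ℤ E k 0) eq) (W-E-even m)
  cases (inj₂ (m , eq)) = trans
    (cong (λ p → W 1ℤ 1ℤ E (suc n) 0 + p * W 1ℤ 1ℤ E (suc n) 0)
      (trans (cong (-1ℤ ^_) eq) (-1^odd m)))
    (cancel (W 1ℤ 1ℤ E (suc n) 0))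

-- Strong induction: once the entries below n vanish, each of (X + 1)ⁿ and (X - 1)ⁿ contributes just
-- its leading term, and the equation becomes 2 sₙ = 0.
functional-unique : ∀ s → (∀ n → W 1ℤ 1ℤ s n 0 + W 1ℤ -1ℤ s n 0 ≡ 0ℤ) → ∀ n → s n ≡ 0ℤ
functional-unique s eq = <-rec (λ n → s n ≡ 0ℤ) λ n rec →
  ℤ.*-cancelˡ-≡ (+ 2) (s n) 0ℤ (begin
    + 2 * s n                        ≡⟨ lemma (s n) ⟩
    s n + s n                        ≡⟨ cong₂ _+_ (leading 1ℤ n rec) (leading -1ℤ n rec) ⟨
    W 1ℤ 1ℤ s n 0 + W 1ℤ -1ℤ s n 0 ≡⟨ eq n ⟩
    0ℤ ∎)
  where
  open ≡-Reasoning
  lemma : ∀ x → + 2 * x ≡ x + x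
  lemma = solve-∀
  leading : ∀ e n → (∀ {j} → j < n → s j ≡ 0ℤ) → W 1ℤ e s n 0 ≡ s n
  leading e n rec = trans
    (W-leading e s n (λ _ → rec) n 0 (ℕ.≤-reflexive (ℕ.+-identityʳ n)))
    (cong s (ℕ.+-identityʳ n))

-- The distribution relation for the factor 5

-- Its exponential generating function is eᶜᵘ times that of E taken at 5u.
F : ℤ → Seq
F c n = W (+ 5) c E n 0

F-0 : ∀ n → F 0ℤ n ≡ (+ 5) ^ n * E n
F-0 n = trans (W-monomial (+ 5) E n 0) (cong (λ k → (+ 5) ^ n * E k) (ℕ.+-identityʳ n))

-- Both sides of the distribution relation satisfy E-functional: replacing X by
-- 5X + 2c, the alternating sum over c telescopes to the terms 5X ± 5.
E-distribution : ∀ n → E n - (+ 5) ^ n * E n ≡ F (+ 4) n + F (- + 4) n - (F (+ 2) n + F (- + 2) n)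
E-distribution n = trans (cong (_-_ (E n)) (sym (F-0 n))) (trans
  (lemma (E n) (F 0ℤ n) (F (+ 4) n + F (- + 4) n) (F (+ 2) n + F (- + 2) n))
  (trans (cong (λ x → x + (F (+ 4) n + F (- + 4) n - (F (+ 2) n + F (- + 2) n)))
    (functional-unique D D-functional n)) (ℤ.+-identityˡ _)))
  where
  lemma : ∀ x y u v → x - y ≡ x - y - (u - v) + (u - v)
  lemma = solve-∀
  D D₄ D₂ : Seq
  D₄ n = F (+ 4) n + F (- + 4) n
  D₂ n = F (+ 2) n + F (- + 2) n
  D  n = E n - F 0ℤ n - (D₄ n - D₂ n)
  WF : ∀ e c n → W 1ℤ e (F c) n 0 ≡ W (+ 5) (c + e) E n 0
  WF e c n = W-substitute (+ 5) c e E n 0 0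
  expand : ∀ e n → W 1ℤ e D n 0 ≡ W 1ℤ e E n 0 - W (+ 5) (0ℤ + e) E n 0
    - (W (+ 5) (+ 4 + e) E n 0 + W (+ 5) (- + 4 + e) E n 0
       - (W (+ 5) (+ 2 + e) E n 0 + W (+ 5) (- + 2 + e) E n 0))
  expand e n
    rewrite W-- 1ℤ e (λ n → E n - F 0ℤ n) (λ n → D₄ n - D₂ n) n 0
          | W-- 1ℤ e E (F 0ℤ) n 0
          | W-- 1ℤ e D₄ D₂ n 0
          | W-+ 1ℤ e (F (+ 4)) (F (- + 4)) n 0
          | W-+ 1ℤ e (F (+ 2)) (F (- + 2)) n 0
          | WF e 0ℤ n | WF e (+ 4) n | WF e (- + 4) n | WF e (+ 2) n | WF e (- + 2) n
    = refl
  telescope : ∀ x y p₅ p₃ p₁ m₁ m₃ m₅ →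
    x - p₁ - (p₅ + m₃ - (p₃ + m₁)) + (y - m₁ - (p₃ + m₅ - (p₁ + m₃))) ≡ x + y - (p₅ + m₅)
  telescope = solve-∀
  factor : ∀ p x y → x + y - (p * x + p * y) ≡ (1ℤ - p) * (x + y)
  factor = solve-∀
  vanish : ∀ n → (1ℤ - (+ 5) ^ n) * (W 1ℤ 1ℤ E n 0 + W 1ℤ -1ℤ E n 0) ≡ 0ℤ
  vanish zero    = refl
  vanish (suc n) = trans (cong (_*_ (1ℤ - (+ 5) ^ suc n)) (E-functional n))
                         (ℤ.*-zeroʳ (1ℤ - (+ 5) ^ suc n))
  D-functional : ∀ n → W 1ℤ 1ℤ D n 0 + W 1ℤ -1ℤ D n 0 ≡ 0ℤ
  D-functional n = begin
    W 1ℤ 1ℤ D n 0 + W 1ℤ -1ℤ D n 0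
      ≡⟨ cong₂ _+_ (expand 1ℤ n) (expand -1ℤ n) ⟩
    _
      ≡⟨ telescope (W 1ℤ 1ℤ E n 0) (W 1ℤ -1ℤ E n 0) (F (+ 5) n) (F (+ 3) n) (F 1ℤ n)
           (F -1ℤ n) (F (- + 3) n) (F (- + 5) n) ⟩
    W 1ℤ 1ℤ E n 0 + W 1ℤ -1ℤ E n 0 - (F (+ 5) n + F (- + 5) n)
      ≡⟨ cong (λ x → W 1ℤ 1ℤ E n 0 + W 1ℤ -1ℤ E n 0 - x)
           (cong₂ _+_ (W-scale (+ 5) 1ℤ E n 0) (W-scale (+ 5) -1ℤ E n 0)) ⟩
    W 1ℤ 1ℤ E n 0 + W 1ℤ -1ℤ E n 0
      - ((+ 5) ^ n * W 1ℤ 1ℤ E n 0 + (+ 5) ^ n * W 1ℤ -1ℤ E n 0)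
      ≡⟨ factor ((+ 5) ^ n) (W 1ℤ 1ℤ E n 0) (W 1ℤ -1ℤ E n 0) ⟩
    (1ℤ - (+ 5) ^ n) * (W 1ℤ 1ℤ E n 0 + W 1ℤ -1ℤ E n 0)
      ≡⟨ vanish n ⟩
    0ℤ ∎
    where open ≡-Reasoning

-- Divisibility of (5X + c)⁴ - 1 by 5

module _ (c q : ℤ) (c⁴ : c * c * c * c ≡ 1ℤ + + 5 * q) (b : ℕ) where

  -- ((5X + c)⁴ - 1) / 5.
  Q : (ℕ → Seq) → ℕ → Seq
  Q G n i = + 125 * G n (4 ℕ.+ i) + + 100 * c * G n (3 ℕ.+ i)
          + + 30 * (c * c) * G n (2 ℕ.+ i) + + 4 * (c * c * c) * G n (suc i) + q * G n i

  -- `Q^ r n i` is the entry at i of Qʳ (5X + c)ⁿ E. The exponent n stays an argument because the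
  -- differences below are taken along n.
  Q^ : ℕ → ℕ → Seq
  Q^ zero    = W (+ 5) c E
  Q^ (suc r) = Q (Q^ r)

  -- Q is a polynomial in X with constant coefficients, so it commutes with 5X + c.
  Q^-suc : ∀ r n i → Q^ r (suc n) i ≡ + 5 * Q^ r n (suc i) + c * Q^ r n i
  Q^-suc zero    n i = refl
  Q^-suc (suc r) n i
    rewrite Q^-suc r n i | Q^-suc r n (suc i) | Q^-suc r n (2 ℕ.+ i)
          | Q^-suc r n (3 ℕ.+ i) | Q^-suc r n (4 ℕ.+ i)
    = lemma c q (G i) (G (suc i)) (G (2 ℕ.+ i)) (G (3 ℕ.+ i)) (G (4 ℕ.+ i)) (G (5 ℕ.+ i))
    where
    G = Q^ r n
    lemma : ∀ c q x₀ x₁ x₂ x₃ x₄ x₅ →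
      + 125 * (+ 5 * x₅ + c * x₄) + + 100 * c * (+ 5 * x₄ + c * x₃)
        + + 30 * (c * c) * (+ 5 * x₃ + c * x₂)
        + + 4 * (c * c * c) * (+ 5 * x₂ + c * x₁) + q * (+ 5 * x₁ + c * x₀)
      ≡ + 5 * (+ 125 * x₅ + + 100 * c * x₄ + + 30 * (c * c) * x₃
               + + 4 * (c * c * c) * x₂ + q * x₁)
        + c * (+ 125 * x₄ + + 100 * c * x₃ + + 30 * (c * c) * x₂
               + + 4 * (c * c * c) * x₁ + q * x₀)
    lemma = solve-∀

  Q^-4+ : ∀ r n i → Q^ r (4 ℕ.+ n) i ≡ Q^ r n i + + 5 * Q^ (suc r) n i
  Q^-4+ r n i = begin
    Q^ r (4 ℕ.+ n) i
      ≡⟨ 4-fold ⟩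
    + 625 * G (4 ℕ.+ i) + + 500 * c * G (3 ℕ.+ i) + + 150 * (c * c) * G (2 ℕ.+ i)
      + + 20 * (c * c * c) * G (suc i) + c * c * c * c * G i
      ≡⟨ cong (λ x → + 625 * G (4 ℕ.+ i) + + 500 * c * G (3 ℕ.+ i) + + 150 * (c * c) * G (2 ℕ.+ i)
      + + 20 * (c * c * c) * G (suc i) + x * G i) c⁴ ⟩
    + 625 * G (4 ℕ.+ i) + + 500 * c * G (3 ℕ.+ i) + + 150 * (c * c) * G (2 ℕ.+ i)
      + + 20 * (c * c * c) * G (suc i) + (1ℤ + + 5 * q) * G i
      ≡⟨ lemma c q (G i) (G (suc i)) (G (2 ℕ.+ i)) (G (3 ℕ.+ i)) (G (4 ℕ.+ i)) ⟩
    Q^ r n i + + 5 * Q^ (suc r) n i ∎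
    where
    open ≡-Reasoning
    G = Q^ r n
    lemma : ∀ c q x₀ x₁ x₂ x₃ x₄ →
      + 625 * x₄ + + 500 * c * x₃ + + 150 * (c * c) * x₂ + + 20 * (c * c * c) * x₁
        + (1ℤ + + 5 * q) * x₀
      ≡ x₀ + + 5 * (+ 125 * x₄ + + 100 * c * x₃ + + 30 * (c * c) * x₂
               + + 4 * (c * c * c) * x₁ + q * x₀)
    lemma = solve-∀
    2-fold : ∀ n i → Q^ r (2 ℕ.+ n) i
      ≡ + 25 * Q^ r n (2 ℕ.+ i) + + 10 * c * Q^ r n (suc i) + c * c * Q^ r n i
    2-fold n i
      rewrite Q^-suc r (suc n) i | Q^-suc r n (suc i) | Q^-suc r n i
      = lemma₂ c (Q^ r n i) (Q^ r n (suc i)) (Q^ r n (2 ℕ.+ i))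
      where
      lemma₂ : ∀ c x₀ x₁ x₂ → + 5 * (+ 5 * x₂ + c * x₁) + c * (+ 5 * x₁ + c * x₀)
        ≡ + 25 * x₂ + + 10 * c * x₁ + c * c * x₀
      lemma₂ = solve-∀
    4-fold : Q^ r (4 ℕ.+ n) i
      ≡ + 625 * G (4 ℕ.+ i) + + 500 * c * G (3 ℕ.+ i) + + 150 * (c * c) * G (2 ℕ.+ i)
      + + 20 * (c * c * c) * G (suc i) + c * c * c * c * G i
    4-fold
      rewrite 2-fold (2 ℕ.+ n) i | 2-fold n i | 2-fold n (suc i) | 2-fold n (2 ℕ.+ i)
      = lemma₄ c (G i) (G (suc i)) (G (2 ℕ.+ i)) (G (3 ℕ.+ i)) (G (4 ℕ.+ i))
      where
      lemma₄ : ∀ c x₀ x₁ x₂ x₃ x₄ →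
        + 25 * (+ 25 * x₄ + + 10 * c * x₃ + c * c * x₂)
          + + 10 * c * (+ 25 * x₃ + + 10 * c * x₂ + c * c * x₁)
          + c * c * (+ 25 * x₂ + + 10 * c * x₁ + c * c * x₀)
        ≡ + 625 * x₄ + + 500 * c * x₃ + + 150 * (c * c) * x₂ + + 20 * (c * c * c) * x₁
          + c * c * c * c * x₀
      lemma₄ = solve-∀

  -- A unit step in t applies (5X + c)⁴ = 1 + 5Q, so the forward difference in t acts as 5Q.
  F-difference : ∀ r t →
    W 1ℤ -1ℤ (λ t → F c (t ℕ.* 4 ℕ.+ b)) r t ≡ (+ 5) ^ r * Q^ r (t ℕ.* 4 ℕ.+ b) 0
  F-difference zero    t = sym (ℤ.*-identityˡ _)
  F-difference (suc r) t
    rewrite F-difference r t | F-difference r (suc t) | Q^-4+ r (t ℕ.* 4 ℕ.+ b) 0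
    = lemma ((+ 5) ^ r) (Q^ r (t ℕ.* 4 ℕ.+ b) 0) (Q^ (suc r) (t ℕ.* 4 ℕ.+ b) 0)
    where
    lemma : ∀ p x y → 1ℤ * (p * (x + + 5 * y)) + -1ℤ * (p * x) ≡ + 5 * p * y
    lemma = solve-∀

-- Differences along the progression and Newton's expansion

-- Euler's factor at 5 removed, along the progression b, b + 4, b + 8, ….
E′ : ℕ → Seq
E′ b t = E (t ℕ.* 4 ℕ.+ b) - (+ 5) ^ (t ℕ.* 4 ℕ.+ b) * E (t ℕ.* 4 ℕ.+ b)

-- X - 1 acts as the forward difference, so Δ b r t is the r-th difference of E′ b at t.
Δ : ℕ → ℕ → Seq
Δ b r t = W 1ℤ -1ℤ (E′ b) r t

5^r∣Δ : ∀ b r t → (+ 5) ^ r S.∣ Δ b r t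
5^r∣Δ b r t = divides
  -- 51 = (4⁴ - 1)/5 and 3 = (2⁴ - 1)/5 are the values of q.
  (Q^ (+ 4) (+ 51) refl b r n 0 + Q^ (- + 4) (+ 51) refl b r n 0
    - (Q^ (+ 2) (+ 3) refl b r n 0 + Q^ (- + 2) (+ 3) refl b r n 0))
  (begin
    Δ b r t
      ≡⟨ W-cong≤ 1ℤ -1ℤ r t (λ t _ → E-distribution (t ℕ.* 4 ℕ.+ b)) ⟩
    W 1ℤ -1ℤ (λ t → g (+ 4) t + g (- + 4) t - (g (+ 2) t + g (- + 2) t)) r t
      ≡⟨ trans (W-- 1ℤ -1ℤ (λ t → g (+ 4) t + g (- + 4) t) (λ t → g (+ 2) t + g (- + 2) t) r t)
           (cong₂ _-_ (W-+ 1ℤ -1ℤ (g (+ 4)) (g (- + 4)) r t)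
                      (W-+ 1ℤ -1ℤ (g (+ 2)) (g (- + 2)) r t)) ⟩
    W 1ℤ -1ℤ (g (+ 4)) r t + W 1ℤ -1ℤ (g (- + 4)) r t
      - (W 1ℤ -1ℤ (g (+ 2)) r t + W 1ℤ -1ℤ (g (- + 2)) r t)
      ≡⟨ cong₂ _-_
           (cong₂ _+_ (F-difference (+ 4) (+ 51) refl b r t) (F-difference (- + 4) (+ 51) refl b r t))
           (cong₂ _+_ (F-difference (+ 2) (+ 3) refl b r t) (F-difference (- + 2) (+ 3) refl b r t)) ⟩
    _ ≡⟨ lemma ((+ 5) ^ r) (Q^ (+ 4) (+ 51) refl b r n 0) (Q^ (- + 4) (+ 51) refl b r n 0)
           (Q^ (+ 2) (+ 3) refl b r n 0) (Q^ (- + 2) (+ 3) refl b r n 0) ⟩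
    _ ∎)
  where
  open ≡-Reasoning
  n = t ℕ.* 4 ℕ.+ b
  g : ℤ → Seq
  g c t = F c (t ℕ.* 4 ℕ.+ b)
  lemma : ∀ p x y u v → p * x + p * y - (p * u + p * v) ≡ (x + y - (u + v)) * p
  lemma = solve-∀

-- X = (X - 1) + 1: the shift Xⁿ is `W 1ℤ 0ℤ`, with 0 = -1 + 1, and `W-substitute` turns it into the
-- n-th power of X + 1 acting on the order of the difference.
Δ-newton : ∀ b r n t B → n < B → Δ b r (n ℕ.+ t) ≡ Σ< B (λ j → + (n C j) * Δ b (r ℕ.+ j) t)
Δ-newton b r n t B n<B = begin
  Δ b r (n ℕ.+ t)                        ≡⟨ ℤ.*-identityˡ _ ⟨
  1ℤ * Δ b r (n ℕ.+ t)                   ≡⟨ cong (λ x → x * Δ b r (n ℕ.+ t)) (ℤ.^-zeroˡ n) ⟨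
  1ℤ ^ n * Δ b r (n ℕ.+ t)               ≡⟨ W-monomial 1ℤ (Δ b r) n t ⟨
  W 1ℤ 0ℤ (Δ b r) n t                   ≡⟨ W-substitute 1ℤ -1ℤ 1ℤ (E′ b) n r t ⟨
  W 1ℤ 1ℤ (λ j → Δ b j t) n r           ≡⟨ W-binomial (λ j → Δ b j t) n B r n<B ⟩
  Σ< B (λ j → + (n C j) * Δ b (r ℕ.+ j) t) ∎
  where open ≡-Reasoning

-- The totient of powers of 5

prime[5] : Prime 5
prime[5] = from-yes (prime? 5)

coprime-5^ : ∀ {i} → ¬ 5 ℕ.∣ i → ∀ n → Coprime i (5 ℕ.^ n)
coprime-5^ 5∤i n (d∣i , d∣5^n) = go n d∣i d∣5^n
  where
  go : ∀ n {d} → d ℕ.∣ _ → d ℕ.∣ 5 ℕ.^ n → d ≡ 1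
  go zero    d∣i d∣1 = ℕ.∣1⇒≡1 d∣1
  go (suc n) {d} d∣i d∣5^n = go n d∣i (coprime-divisor d-coprime-5 d∣5^n)
    where
    d-coprime-5 : Coprime d 5
    d-coprime-5 (e∣d , e∣5) with prime⇒irreducible prime[5] e∣5
    ... | inj₁ e≡1  = e≡1
    ... | inj₂ refl = contradiction (ℕ.∣-trans e∣d d∣i) 5∤i

-- The list is consumed in blocks of five. Replacing f by `f ∘ (5 ℕ.+_)` preserves the hypothesis,
-- as `suc q ℕ.* 5` computes to 5 + q·5.
length-filter-4-of-5 : ∀ {P : Pred ℕ 0ℓ} (P? : Decidable P) (f : ℕ → ℕ) →
  (∀ q → P (f (q ℕ.* 5)) × P (f (1 ℕ.+ q ℕ.* 5)) × P (f (2 ℕ.+ q ℕ.* 5)) ×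
         P (f (3 ℕ.+ q ℕ.* 5)) × ¬ P (f (4 ℕ.+ q ℕ.* 5))) →
  ∀ N → length (filter P? (applyUpTo f (N ℕ.* 5))) ≡ N ℕ.* 4
length-filter-4-of-5 P? f h zero = refl
length-filter-4-of-5 P? f h (suc N) with h 0
... | p₀ , p₁ , p₂ , p₃ , ¬p₄
  rewrite List.filter-accept P? {xs = applyUpTo (f ∘ suc) (4 ℕ.+ N ℕ.* 5)} p₀
        | List.filter-accept P? {xs = applyUpTo (f ∘ (2 ℕ.+_)) (3 ℕ.+ N ℕ.* 5)} p₁
        | List.filter-accept P? {xs = applyUpTo (f ∘ (3 ℕ.+_)) (2 ℕ.+ N ℕ.* 5)} p₂
        | List.filter-accept P? {xs = applyUpTo (f ∘ (4 ℕ.+_)) (1 ℕ.+ N ℕ.* 5)} p₃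
        | List.filter-reject P? {xs = applyUpTo (f ∘ (5 ℕ.+_)) (N ℕ.* 5)} ¬p₄
  = cong (4 ℕ.+_) (length-filter-4-of-5 P? (f ∘ (5 ℕ.+_)) (h ∘ suc) N)

φ-5^ : ∀ n → φ (5 ℕ.^ suc n) ≡ 5 ℕ.^ n ℕ.* 4
φ-5^ n = begin
  length (filter P? (map suc (upTo (5 ℕ.* 5 ℕ.^ n))))
    ≡⟨ cong (λ xs → length (filter P? xs)) (List.map-applyUpTo id suc (5 ℕ.* 5 ℕ.^ n)) ⟩
  length (filter P? (applyUpTo suc (5 ℕ.* 5 ℕ.^ n)))
    ≡⟨ cong (λ k → length (filter P? (applyUpTo suc k))) (ℕ.*-comm 5 (5 ℕ.^ n)) ⟩
  length (filter P? (applyUpTo suc (5 ℕ.^ n ℕ.* 5)))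
    ≡⟨ length-filter-4-of-5 P? suc residues (5 ℕ.^ n) ⟩
  5 ℕ.^ n ℕ.* 4 ∎
  where
  open ≡-Reasoning
  P? : Decidable (λ i → Coprime i (5 ℕ.^ suc n))
  P? i = coprime? i (5 ℕ.^ suc n)
  5∤ : ∀ r → ¬ 5 ℕ.∣ r → ∀ q → Coprime (r ℕ.+ q ℕ.* 5) (5 ℕ.^ suc n)
  5∤ r 5∤r q = coprime-5^ (λ d → 5∤r (ℕ.∣m+n∣m⇒∣n
    (subst (5 ℕ.∣_) (ℕ.+-comm r (q ℕ.* 5)) d) (ℕ.n∣m*n q))) (suc n)
  P : Pred ℕ 0ℓ
  P i = Coprime i (5 ℕ.^ suc n)
  residues : ∀ q → P (1 ℕ.+ q ℕ.* 5) × P (2 ℕ.+ q ℕ.* 5) × P (3 ℕ.+ q ℕ.* 5) ×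
                   P (4 ℕ.+ q ℕ.* 5) × ¬ P (5 ℕ.+ q ℕ.* 5)
  residues q =
    5∤ 1 (from-no (5 ℕ.∣? 1)) q , 5∤ 2 (from-no (5 ℕ.∣? 2)) q ,
    5∤ 3 (from-no (5 ℕ.∣? 3)) q , 5∤ 4 (from-no (5 ℕ.∣? 4)) q ,
    λ c → contradiction (c (ℕ.n∣m*n (suc q) , ℕ.m∣m*n (5 ℕ.^ n))) λ ()

-- Cancellation of powers of 5, and tails of Newton's expansion

-- The first hypothesis says v₅(r) ≤ w. By Euclid's lemma each factor 5 of r·x is charged either to
-- x, which lowers N, or to r, which lowers w.
5^-cancel-ℕ : ∀ w N r x → ¬ 5 ℕ.^ suc w ℕ.∣ r → 5 ℕ.^ (N ℕ.+ w) ℕ.∣ r ℕ.* x → 5 ℕ.^ N ℕ.∣ x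
5^-cancel-ℕ w zero    r x ∤r d = ℕ.1∣ x
5^-cancel-ℕ w (suc N) r x ∤r d
  with euclidsLemma r x prime[5] (ℕ.∣-trans (ℕ.m∣m*n (5 ℕ.^ (N ℕ.+ w))) d)
... | inj₂ (ℕ.divides-refl x′) =
  subst (5 ℕ.^ suc N ℕ.∣_) (ℕ.*-comm 5 x′) (ℕ.*-monoʳ-∣ 5 (5^-cancel-ℕ w N r x′ ∤r
    (ℕ.*-cancelˡ-∣ 5 (subst (5 ℕ.^ suc (N ℕ.+ w) ℕ.∣_)
      (trans (sym (ℕ.*-assoc r x′ 5)) (ℕ.*-comm (r ℕ.* x′) 5)) d))))
5^-cancel-ℕ zero    (suc N) r x ∤r d | inj₁ 5∣r = contradiction 5∣r ∤r
5^-cancel-ℕ (suc w) (suc N) r x ∤r d | inj₁ (ℕ.divides-refl r′) =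
  5^-cancel-ℕ w (suc N) r′ x
    (λ d′ → ∤r (subst (5 ℕ.^ suc (suc w) ℕ.∣_) (ℕ.*-comm 5 r′) (ℕ.*-monoʳ-∣ 5 d′)))
    (ℕ.*-cancelˡ-∣ 5 (subst₂ ℕ._∣_ (cong (5 ℕ.^_) (cong suc (ℕ.+-suc N w)))
      (trans (cong (ℕ._* x) (ℕ.*-comm r′ 5)) (ℕ.*-assoc 5 r′ x)) d))

pos-5^ : ∀ n → + (5 ℕ.^ n) ≡ (+ 5) ^ n
pos-5^ zero    = refl
pos-5^ (suc n) = trans (ℤ.pos-* 5 (5 ℕ.^ n)) (cong (_*_ (+ 5)) (pos-5^ n))

5^-cancel : ∀ w N r x → ¬ 5 ℕ.^ suc w ℕ.∣ r → (+ 5) ^ (N ℕ.+ w) S.∣ + r * x → (+ 5) ^ N S.∣ x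
5^-cancel w N r x ∤r d = subst (S._∣ x) (pos-5^ N) (S.∣ᵤ⇒∣ (5^-cancel-ℕ w N r ∣ x ∣ ∤r
  (subst (5 ℕ.^ (N ℕ.+ w) ℕ.∣_) (ℤ.abs-* (+ r) x)
    (S.∣⇒∣ᵤ (subst (S._∣ + r * x) (sym (pos-5^ (N ℕ.+ w))) d)))))

∣-* : ∀ {a b x y} → a S.∣ x → b S.∣ y → a * b S.∣ x * y
∣-* {a} {b} (divides p refl) (divides q refl) = divides (p * q) (lemma p a q b)
  where
  lemma : ∀ p a q b → p * a * (q * b) ≡ p * q * (a * b)
  lemma = solve-∀

5^-≤-∣ : ∀ {m n} → m ≤ n → (+ 5) ^ m S.∣ (+ 5) ^ n
5^-≤-∣ {m} m≤n with ℕ.m≤n⇒∃[o]m+o≡n m≤n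
... | o , refl = divides ((+ 5) ^ o) (trans (ℤ.^-distribˡ-+-* (+ 5) m o) (ℤ.*-comm ((+ 5) ^ m) ((+ 5) ^ o)))

Σ<-truncate : ∀ d p B (h : Seq) → (∀ j → p ≤ j → d S.∣ h j) → d S.∣ Σ< (p ℕ.+ B) h - Σ< p h
Σ<-truncate d zero    zero    h d∣h = divides 0ℤ refl
Σ<-truncate d zero    (suc B) h d∣h =
  subst (d S.∣_) (lemma (h 0) (Σ< B (h ∘ suc)))
    (S.∣m∣n⇒∣m+n (d∣h 0 z≤n) (Σ<-truncate d 0 B (h ∘ suc) (λ j _ → d∣h (suc j) z≤n)))
  where
  lemma : ∀ x y → x + (y - 0ℤ) ≡ x + y - 0ℤ
  lemma = solve-∀
Σ<-truncate d (suc p) B       h d∣h =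
  subst (d S.∣_) (lemma (h 0) (Σ< (p ℕ.+ B) (h ∘ suc)) (Σ< p (h ∘ suc)))
    (Σ<-truncate d p B (h ∘ suc) (λ j le → d∣h (suc j) (s≤s le)))
  where
  lemma : ∀ x y z → y - z ≡ x + y - (x + z)
  lemma = solve-∀

-- Over ℤ no restriction s ≤ n is needed: n - s is not truncated, and for s > n both binomials
-- vanish.
C-falling : ∀ n s → + suc s * + (n C suc s) ≡ (+ n - + s) * + (n C s)
C-falling zero    zero    = refl
C-falling zero    (suc s) = trans (ℤ.*-zeroʳ (+ suc (suc s))) (sym (ℤ.*-zeroʳ (0ℤ - + suc s)))
C-falling (suc n) zero
  rewrite sym (nCk+nC[k+1]≡[n+1]C[k+1] n 0) = lemma (+ n) (+ (n C 1)) (C-falling n 0)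
  where
  lemma : ∀ n x → 1ℤ * x ≡ (n - 0ℤ) * 1ℤ → 1ℤ * (1ℤ + x) ≡ (1ℤ + n - 0ℤ) * 1ℤ
  lemma n x eq = trans (lemma₁ x) (trans (cong (_+_ 1ℤ) eq) (lemma₂ n))
    where
    lemma₁ : ∀ x → 1ℤ * (1ℤ + x) ≡ 1ℤ + 1ℤ * x
    lemma₁ = solve-∀
    lemma₂ : ∀ n → 1ℤ + (n - 0ℤ) * 1ℤ ≡ (1ℤ + n - 0ℤ) * 1ℤ
    lemma₂ = solve-∀
C-falling (suc n) (suc s)
  rewrite sym (nCk+nC[k+1]≡[n+1]C[k+1] n s) | sym (nCk+nC[k+1]≡[n+1]C[k+1] n (suc s))
  = lemma (+ n) (+ s) (+ (n C s)) (+ (n C suc s)) (+ (n C suc (suc s)))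
      (C-falling n s) (C-falling n (suc s))
  where
  lemma : ∀ n s x y z → (1ℤ + s) * y ≡ (n - s) * x →
    (1ℤ + (1ℤ + s)) * z ≡ (n - (1ℤ + s)) * y →
    (1ℤ + (1ℤ + s)) * (y + z) ≡ (1ℤ + n - (1ℤ + s)) * (x + y)
  lemma n s x y z eq₁ eq₂ = trans (lemma₁ s y z) (trans (cong (_+_ ((1ℤ + (1ℤ + s)) * y)) eq₂)
    (trans (lemma₂ n s y) (trans (cong (λ w → w + (n - s) * y) eq₁) (lemma₃ n s x y))))
    where
    lemma₁ : ∀ s y z → (1ℤ + (1ℤ + s)) * (y + z) ≡ (1ℤ + (1ℤ + s)) * y + (1ℤ + (1ℤ + s)) * z
    lemma₁ = solve-∀
    lemma₂ : ∀ n s y → (1ℤ + (1ℤ + s)) * y + (n - (1ℤ + s)) * y ≡ (1ℤ + s) * y + (n - s) * y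
    lemma₂ = solve-∀
    lemma₃ : ∀ n s x y → (n - s) * x + (n - s) * y ≡ (1ℤ + n - (1ℤ + s)) * (x + y)
    lemma₃ = solve-∀

C-absorb : ∀ n s → + suc s * + (suc n C suc s) ≡ + suc n * + (n C s)
C-absorb n s rewrite sym (nCk+nC[k+1]≡[n+1]C[k+1] n s) =
  trans (ℤ.*-distribˡ-+ (+ suc s) (+ (n C s)) (+ (n C suc s)))
    (trans (cong (_+_ (+ suc s * + (n C s))) (C-falling n s))
      (lemma (+ n) (+ s) (+ (n C s))))
  where
  lemma : ∀ n s x → (1ℤ + s) * x + (n - s) * x ≡ (1ℤ + n) * x
  lemma = solve-∀

7+i<5^[2+i] : ∀ i → 7 ℕ.+ i < 5 ℕ.^ suc (suc i)
7+i<5^[2+i] zero    = ℕ.m≤m+n 8 17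
7+i<5^[2+i] (suc i) = ℕ.≤-trans (s≤s (7+i<5^[2+i] i)) (ℕ.≤-trans
    (ℕ.+-monoˡ-≤ p (ℕ.>-nonZero⁻¹ p {{ℕ.m^n≢0 5 (suc (suc i))}}))
    (ℕ.+-monoʳ-≤ p (ℕ.m≤m+n p (3 ℕ.* p))))
  where p = 5 ℕ.^ suc (suc i)

-- This is v₅(r) ≤ r - 6 for r = 6 + i.
5^[1+i]∤6+i : ∀ i → ¬ 5 ℕ.^ suc i ℕ.∣ 6 ℕ.+ i
-- Size alone does not decide this case, since 5 < 6; from i = 1 on the power is the larger number.
5^[1+i]∤6+i zero    = from-no (5 ℕ.∣? 6)
5^[1+i]∤6+i (suc i) = ℕ.>⇒∤ (7+i<5^[2+i] i)

-- From r C(K, r) = K C(K - 1, r - 1), the power 5ᵃ⁺ʳ divides r C(K, r) x; cancelling r costs at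
-- most r - 6 factors 5.
C-tail : ∀ a K r x → 6 ≤ r → (+ 5) ^ a S.∣ + K → (+ 5) ^ r S.∣ x → (+ 5) ^ (a ℕ.+ 6) S.∣ + (K C r) * x
C-tail a zero    (suc r) x _ _ _ = divides 0ℤ refl
C-tail a (suc n) r x 6≤r a∣K r∣x with ℕ.m≤n⇒∃[o]m+o≡n 6≤r
... | i , refl = 5^-cancel i (a ℕ.+ 6) (6 ℕ.+ i) (+ (suc n C (6 ℕ.+ i)) * x) (5^[1+i]∤6+i i)
  (subst₂ S._∣_ exponent absorb (∣-* (∣-* a∣K (divides c (sym (ℤ.*-identityʳ c)))) r∣x))
  where
  c = + (n C (5 ℕ.+ i))
  exponent : (+ 5) ^ a * 1ℤ * (+ 5) ^ (6 ℕ.+ i) ≡ (+ 5) ^ (a ℕ.+ 6 ℕ.+ i)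
  exponent = trans (cong (_* (+ 5) ^ (6 ℕ.+ i)) (ℤ.*-identityʳ ((+ 5) ^ a)))
    (trans (sym (ℤ.^-distribˡ-+-* (+ 5) a (6 ℕ.+ i))) (cong ((+ 5) ^_) (sym (ℕ.+-assoc a 6 i))))
  absorb : + suc n * c * x ≡ + (6 ℕ.+ i) * (+ (suc n C (6 ℕ.+ i)) * x)
  absorb = trans (cong (_* x) (sym (C-absorb n (5 ℕ.+ i))))
    (ℤ.*-assoc (+ (6 ℕ.+ i)) (+ (suc n C (6 ℕ.+ i))) x)

Δ-truncate : ∀ b r p t →
  (+ 5) ^ (p ℕ.+ r) S.∣ Δ b r t - Σ< p (λ j → + (t C j) * Δ b (r ℕ.+ j) 0)
Δ-truncate b r p t = subst (λ x → (+ 5) ^ (p ℕ.+ r) S.∣ x - Σ< p h)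
  (trans (sym (Δ-newton b r t 0 (p ℕ.+ suc t) (ℕ.m≤n+m (suc t) p))) (cong (Δ b r) (ℕ.+-identityʳ t)))
  (Σ<-truncate ((+ 5) ^ (p ℕ.+ r)) p (suc t) h λ j p≤j →
    S.∣n⇒∣m*n (+ (t C j)) (S.∣-trans
      (5^-≤-∣ (ℕ.≤-trans (ℕ.+-monoˡ-≤ r p≤j) (ℕ.≤-reflexive (ℕ.+-comm j r))))
      (5^r∣Δ b (r ℕ.+ j) 0)))
  where
  h : Seq
  h j = + (t C j) * Δ b (r ℕ.+ j) 0

-- The logarithm as the part of Newton's expansion linear in K

-- 120 log(1 + Δ), truncated after Δ⁵.
logΔ : ℕ → ℕ → ℤ
logΔ b t = + 120 * Δ b 1 t - + 60 * Δ b 2 t + + 40 * Δ b 3 t - + 30 * Δ b 4 t + + 24 * Δ b 5 t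

-- With κᵣ = C(K, r): the part linear in K is separated from a multiple of K².
falling-expansion : ∀ K κ₁ κ₂ κ₃ κ₄ κ₅ P d₁ d₂ d₃ d₄ d₅ →
  1ℤ * κ₁ ≡ (K - 0ℤ) * 1ℤ → + 2 * κ₂ ≡ (K - + 1) * κ₁ → + 3 * κ₃ ≡ (K - + 2) * κ₂ →
  + 4 * κ₄ ≡ (K - + 3) * κ₃ → + 5 * κ₅ ≡ (K - + 4) * κ₄ →
  + 120 * (κ₁ * d₁ + κ₂ * d₂ + κ₃ * d₃ + κ₄ * d₄ + κ₅ * d₅ - K * P)
  ≡ K * (+ 120 * d₁ - + 60 * d₂ + + 40 * d₃ - + 30 * d₄ + + 24 * d₅ - + 120 * P)
    + K * K * (+ 60 * d₂ + + 20 * (K - + 3) * d₃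
      + + 5 * (K * K - + 6 * K + + 11) * d₄
      + (K * K * K - + 10 * (K * K) + + 35 * K - + 50) * d₅)
falling-expansion K κ₁ κ₂ κ₃ κ₄ κ₅ P d₁ d₂ d₃ d₄ d₅ e₁ e₂ e₃ e₄ e₅ = begin
  + 120 * (κ₁ * d₁ + κ₂ * d₂ + κ₃ * d₃ + κ₄ * d₄ + κ₅ * d₅ - K * P)
    -- A Horner scheme from the top: 120 = 24·5 exposes 5 κ₅, whose replacement exposes 4 κ₄ with
    -- factor 6, then 3 κ₃ and 2 κ₂, so nothing is ever divided.
    ≡⟨ s₀ K κ₁ κ₂ κ₃ κ₄ κ₅ P d₁ d₂ d₃ d₄ d₅ ⟩
  + 120 * (κ₁ * d₁ + κ₂ * d₂ + κ₃ * d₃ + κ₄ * d₄ - K * P) + + 24 * (+ 5 * κ₅) * d₅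
    ≡⟨ cong (λ x → + 120 * (κ₁ * d₁ + κ₂ * d₂ + κ₃ * d₃ + κ₄ * d₄ - K * P) + + 24 * x * d₅) e₅ ⟩
  + 120 * (κ₁ * d₁ + κ₂ * d₂ + κ₃ * d₃ + κ₄ * d₄ - K * P) + + 24 * ((K - + 4) * κ₄) * d₅
    ≡⟨ s₁ K κ₁ κ₂ κ₃ κ₄ P d₁ d₂ d₃ d₄ d₅ ⟩
  + 120 * (κ₁ * d₁ + κ₂ * d₂ + κ₃ * d₃ - K * P)
    + + 6 * (+ 4 * κ₄) * (+ 5 * d₄ + (K - + 4) * d₅)
    ≡⟨ cong (λ x → + 120 * (κ₁ * d₁ + κ₂ * d₂ + κ₃ * d₃ - K * P)
         + + 6 * x * (+ 5 * d₄ + (K - + 4) * d₅)) e₄ ⟩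
  + 120 * (κ₁ * d₁ + κ₂ * d₂ + κ₃ * d₃ - K * P)
    + + 6 * ((K - + 3) * κ₃) * (+ 5 * d₄ + (K - + 4) * d₅)
    ≡⟨ s₂ K κ₁ κ₂ κ₃ P d₁ d₂ d₃ d₄ d₅ ⟩
  + 120 * (κ₁ * d₁ + κ₂ * d₂ - K * P)
    + + 2 * (+ 3 * κ₃) * (+ 20 * d₃ + (K - + 3) * (+ 5 * d₄ + (K - + 4) * d₅))
    ≡⟨ cong (λ x → + 120 * (κ₁ * d₁ + κ₂ * d₂ - K * P)
         + + 2 * x * (+ 20 * d₃ + (K - + 3) * (+ 5 * d₄ + (K - + 4) * d₅))) e₃ ⟩
  + 120 * (κ₁ * d₁ + κ₂ * d₂ - K * P)
    + + 2 * ((K - + 2) * κ₂) * (+ 20 * d₃ + (K - + 3) * (+ 5 * d₄ + (K - + 4) * d₅))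
    ≡⟨ s₃ K κ₁ κ₂ P d₁ d₂ d₃ d₄ d₅ ⟩
  + 120 * (κ₁ * d₁ - K * P)
    + + 2 * κ₂ * (+ 60 * d₂ + (K - + 2) * (+ 20 * d₃ + (K - + 3) * (+ 5 * d₄ + (K - + 4) * d₅)))
    ≡⟨ cong₂ (λ x y → + 120 * (x * d₁ - K * P)
         + y * (+ 60 * d₂ + (K - + 2) * (+ 20 * d₃ + (K - + 3) * (+ 5 * d₄ + (K - + 4) * d₅))))
         κ₁≡K (trans e₂ (cong (_*_ (K - + 1)) κ₁≡K)) ⟩
  + 120 * (K * d₁ - K * P)
    + (K - + 1) * K * (+ 60 * d₂ + (K - + 2) * (+ 20 * d₃ + (K - + 3) * (+ 5 * d₄ + (K - + 4) * d₅)))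
    ≡⟨ s₄ K P d₁ d₂ d₃ d₄ d₅ ⟩
  K * (+ 120 * d₁ - + 60 * d₂ + + 40 * d₃ - + 30 * d₄ + + 24 * d₅ - + 120 * P)
    + K * K * (+ 60 * d₂ + + 20 * (K - + 3) * d₃
      + + 5 * (K * K - + 6 * K + + 11) * d₄
      + (K * K * K - + 10 * (K * K) + + 35 * K - + 50) * d₅) ∎
  where
  open ≡-Reasoning
  κ₁≡K : κ₁ ≡ K
  κ₁≡K = trans (sym (ℤ.*-identityˡ κ₁)) (trans e₁ (s K))
    where
    s : ∀ K → (K - 0ℤ) * 1ℤ ≡ K
    s = solve-∀
  s₀ : ∀ K κ₁ κ₂ κ₃ κ₄ κ₅ P d₁ d₂ d₃ d₄ d₅ →
    + 120 * (κ₁ * d₁ + κ₂ * d₂ + κ₃ * d₃ + κ₄ * d₄ + κ₅ * d₅ - K * P)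
    ≡ + 120 * (κ₁ * d₁ + κ₂ * d₂ + κ₃ * d₃ + κ₄ * d₄ - K * P) + + 24 * (+ 5 * κ₅) * d₅
  s₀ = solve-∀
  s₁ : ∀ K κ₁ κ₂ κ₃ κ₄ P d₁ d₂ d₃ d₄ d₅ →
    + 120 * (κ₁ * d₁ + κ₂ * d₂ + κ₃ * d₃ + κ₄ * d₄ - K * P) + + 24 * ((K - + 4) * κ₄) * d₅
    ≡ + 120 * (κ₁ * d₁ + κ₂ * d₂ + κ₃ * d₃ - K * P)
      + + 6 * (+ 4 * κ₄) * (+ 5 * d₄ + (K - + 4) * d₅)
  s₁ = solve-∀
  s₂ : ∀ K κ₁ κ₂ κ₃ P d₁ d₂ d₃ d₄ d₅ →
    + 120 * (κ₁ * d₁ + κ₂ * d₂ + κ₃ * d₃ - K * P)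
      + + 6 * ((K - + 3) * κ₃) * (+ 5 * d₄ + (K - + 4) * d₅)
    ≡ + 120 * (κ₁ * d₁ + κ₂ * d₂ - K * P)
      + + 2 * (+ 3 * κ₃) * (+ 20 * d₃ + (K - + 3) * (+ 5 * d₄ + (K - + 4) * d₅))
  s₂ = solve-∀
  s₃ : ∀ K κ₁ κ₂ P d₁ d₂ d₃ d₄ d₅ →
    + 120 * (κ₁ * d₁ + κ₂ * d₂ - K * P)
      + + 2 * ((K - + 2) * κ₂) * (+ 20 * d₃ + (K - + 3) * (+ 5 * d₄ + (K - + 4) * d₅))
    ≡ + 120 * (κ₁ * d₁ - K * P)
      + + 2 * κ₂ * (+ 60 * d₂ + (K - + 2) * (+ 20 * d₃ + (K - + 3) * (+ 5 * d₄ + (K - + 4) * d₅)))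
  s₃ = solve-∀
  s₄ : ∀ K P d₁ d₂ d₃ d₄ d₅ →
    + 120 * (K * d₁ - K * P)
      + (K - + 1) * K * (+ 60 * d₂ + (K - + 2) * (+ 20 * d₃ + (K - + 3) * (+ 5 * d₄ + (K - + 4) * d₅)))
    ≡ K * (+ 120 * d₁ - + 60 * d₂ + + 40 * d₃ - + 30 * d₄ + + 24 * d₅ - + 120 * P)
      + K * K * (+ 60 * d₂ + + 20 * (K - + 3) * d₃
        + + 5 * (K * K - + 6 * K + + 11) * d₄
        + (K * K * K - + 10 * (K * K) + + 35 * K - + 50) * d₅)
  s₄ = solve-∀

-- Orders r ≥ 6 go by `C-tail`. The rest is multiplied by 120, where both parts of
-- `falling-expansion` are divisible by 5ᵃ⁺⁷: the linear one as 5ᵃ·5⁷, the one with K² as 5ᵃ·5⁴·5³,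
-- using a ≥ 4.
E′-difference : ∀ b a k t P → 4 ≤ a → (+ 5) ^ 7 S.∣ logΔ b t - + 120 * P →
  (+ 5) ^ (a ℕ.+ 6) S.∣ E′ b (k ℕ.* 5 ℕ.^ a ℕ.+ t) - E′ b t - + (k ℕ.* 5 ℕ.^ a) * P
E′-difference b a k t P 4≤a log≡P =
  subst ((+ 5) ^ (a ℕ.+ 6) S.∣_)
    (split (E′ b (K ℕ.+ t)) (E′ b t) κ₁ κ₂ κ₃ κ₄ κ₅ (+ K * P)
      (Δ b 1 t) (Δ b 2 t) (Δ b 3 t) (Δ b 4 t) (Δ b 5 t))
    (S.∣m∣n⇒∣m+n tail head)
  where
  K = k ℕ.* 5 ℕ.^ a
  κ₁ = + (K C 1)
  κ₂ = + (K C 2)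
  κ₃ = + (K C 3)
  κ₄ = + (K C 4)
  κ₅ = + (K C 5)
  h : Seq
  h j = + (K C j) * Δ b j t
  main = κ₁ * Δ b 1 t + κ₂ * Δ b 2 t + κ₃ * Δ b 3 t + κ₄ * Δ b 4 t + κ₅ * Δ b 5 t
  split : ∀ x y κ₁ κ₂ κ₃ κ₄ κ₅ p d₁ d₂ d₃ d₄ d₅ →
    x - (1ℤ * y + (κ₁ * d₁ + (κ₂ * d₂ + (κ₃ * d₃ + (κ₄ * d₄ + (κ₅ * d₅ + 0ℤ))))))
      + (κ₁ * d₁ + κ₂ * d₂ + κ₃ * d₃ + κ₄ * d₄ + κ₅ * d₅ - p)
    ≡ x - y - p
  split = solve-∀
  5^a∣K : (+ 5) ^ a S.∣ + K
  5^a∣K = divides (+ k) (trans (ℤ.pos-* k (5 ℕ.^ a)) (cong (_*_ (+ k)) (pos-5^ a)))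
  tail : (+ 5) ^ (a ℕ.+ 6) S.∣ E′ b (K ℕ.+ t) - Σ< 6 h
  tail = subst (λ x → (+ 5) ^ (a ℕ.+ 6) S.∣ x - Σ< 6 h)
    (sym (Δ-newton b 0 K t (6 ℕ.+ suc K) (ℕ.m≤n+m (suc K) 6)))
    (Σ<-truncate ((+ 5) ^ (a ℕ.+ 6)) 6 (suc K) h λ j 6≤j →
      C-tail a K j (Δ b j t) 6≤j 5^a∣K (5^r∣Δ b j t))
  R = + 60 * Δ b 2 t + + 20 * (+ K - + 3) * Δ b 3 t
    + + 5 * (+ K * + K - + 6 * + K + + 11) * Δ b 4 t
    + (+ K * + K * + K - + 10 * (+ K * + K) + + 35 * + K - + 50) * Δ b 5 t
  factor : + 120 * (main - + K * P) ≡ + K * (logΔ b t - + 120 * P) + + K * + K * R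
  factor = falling-expansion (+ K) κ₁ κ₂ κ₃ κ₄ κ₅ P (Δ b 1 t) (Δ b 2 t) (Δ b 3 t) (Δ b 4 t) (Δ b 5 t)
    (C-falling K 0) (C-falling K 1) (C-falling K 2) (C-falling K 3) (C-falling K 4)
  -- The second difference brings only 5²; its coefficient 60 supplies the missing 5.
  5^3∣R : (+ 5) ^ 3 S.∣ R
  5^3∣R = S.∣m∣n⇒∣m+n (S.∣m∣n⇒∣m+n (S.∣m∣n⇒∣m+n
    (∣-* {+ 5} {+ 25} (divides (+ 12) refl) (5^r∣Δ b 2 t))
    (S.∣n⇒∣m*n (+ 20 * (+ K - + 3)) (5^r∣Δ b 3 t)))
    (S.∣n⇒∣m*n (+ 5 * (+ K * + K - + 6 * + K + + 11)) (S.∣-trans (5^-≤-∣ (ℕ.m≤m+n 3 1)) (5^r∣Δ b 4 t))))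
    (S.∣n⇒∣m*n (+ K * + K * + K - + 10 * (+ K * + K) + + 35 * + K - + 50)
      (S.∣-trans (5^-≤-∣ (ℕ.m≤m+n 3 2)) (5^r∣Δ b 5 t)))
  head : (+ 5) ^ (a ℕ.+ 6) S.∣ main - + K * P
  -- 120 contains exactly one factor 5, so one power is lost.
  head = 5^-cancel 1 (a ℕ.+ 6) 120 (main - + K * P) (from-no (25 ℕ.∣? 120))
    (subst₂ S._∣_ (trans (sym (ℤ.^-distribˡ-+-* (+ 5) a 7)) (cong ((+ 5) ^_) (sym (ℕ.+-assoc a 6 1))))
      (sym factor)
      (S.∣m∣n⇒∣m+n (∣-* 5^a∣K log≡P)
        (subst (S._∣ + K * + K * R) (exponent ((+ 5) ^ a))
          (∣-* (∣-* 5^a∣K (S.∣-trans (5^-≤-∣ 4≤a) 5^a∣K)) 5^3∣R))))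
    where
    exponent : ∀ x → x * (+ 5) ^ 4 * (+ 5) ^ 3 ≡ x * (+ 5) ^ 7
    exponent x = ℤ.*-assoc x ((+ 5) ^ 4) ((+ 5) ^ 3)

-- The logarithm mod 5⁷ as a quartic polynomial in t

-- The coefficient of the binomial t C s in logΔ b t - 120 Σ aᵢ tⁱ, up to terms that vanish
-- mod 5⁷, when d r = Δ b r 0.
newtonCoeff : (a₀ a₁ a₂ a₃ a₄ : ℤ) → Seq → ℕ → ℤ
newtonCoeff a₀ a₁ a₂ a₃ a₄ d 0 =
  + 120 * d 1 - + 60 * d 2 + + 40 * d 3 - + 30 * d 4 + + 24 * d 5 - + 120 * a₀
newtonCoeff a₀ a₁ a₂ a₃ a₄ d 1 =
  + 120 * d 2 - + 60 * d 3 + + 40 * d 4 - + 30 * d 5 + + 24 * d 6 - + 120 * (a₁ + a₂ + a₃ + a₄)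
newtonCoeff a₀ a₁ a₂ a₃ a₄ d 2 =
  + 120 * d 3 - + 60 * d 4 + + 40 * d 5 - + 120 * (+ 2 * a₂ + + 6 * a₃ + + 14 * a₄)
newtonCoeff a₀ a₁ a₂ a₃ a₄ d 3 = + 120 * d 4 - + 60 * d 5 - + 120 * (+ 6 * a₃ + + 36 * a₄)
newtonCoeff a₀ a₁ a₂ a₃ a₄ d _ = + 120 * d 5 - + 120 * (+ 24 * a₄)

newtonCoeff-cong : ∀ a₀ a₁ a₂ a₃ a₄ {u v : Seq} → (∀ j → j ≤ 6 → u j ≡ v j) →
  ∀ s → newtonCoeff a₀ a₁ a₂ a₃ a₄ u s ≡ newtonCoeff a₀ a₁ a₂ a₃ a₄ v s
newtonCoeff-cong a₀ a₁ a₂ a₃ a₄ eq s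
  with eq₁ ← eq 1 (ℕ.m≤m+n 1 5) | eq₂ ← eq 2 (ℕ.m≤m+n 2 4) | eq₃ ← eq 3 (ℕ.m≤m+n 3 3)
     | eq₄ ← eq 4 (ℕ.m≤m+n 4 2) | eq₅ ← eq 5 (ℕ.m≤m+n 5 1) | eq₆ ← eq 6 (ℕ.m≤m+n 6 0)
  with s
... | 0 rewrite eq₁ | eq₂ | eq₃ | eq₄ | eq₅ = refl
... | 1 rewrite eq₂ | eq₃ | eq₄ | eq₅ | eq₆ = refl
... | 2 rewrite eq₃ | eq₄ | eq₅ = refl
... | 3 rewrite eq₄ | eq₅ = refl
... | suc (suc (suc (suc _))) rewrite eq₅ = refl

module _ (b : ℕ) (a₀ a₁ a₂ a₃ a₄ : ℤ) where

  private
    d : Seq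
    d r = Δ b r 0

  logΔ-polynomial : (∀ (s : Fin 5) → (+ 5) ^ 7 S.∣ newtonCoeff a₀ a₁ a₂ a₃ a₄ d (toℕ s)) →
    ∀ t → (+ 5) ^ 7 S.∣ logΔ b t
    - + 120 * (a₀ + a₁ * + t + a₂ * (+ t * + t) + a₃ * (+ t * + t * + t) + a₄ * (+ t * + t * + t * + t))
  logΔ-polynomial h t = subst ((+ 5) ^ 7 S.∣_)
    (combine (+ t) c₁ c₂ c₃ c₄ a₀ a₁ a₂ a₃ a₄
      (d 1) (d 2) (d 3) (d 4) (d 5) (d 6) (Δ b 1 t) (Δ b 2 t) (Δ b 3 t) (Δ b 4 t) (Δ b 5 t)
      t≡ t²≡ t³≡ t⁴≡)
    (S.∣m∣n⇒∣m+n truncations coefficients)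
    where
    c₁ = + (t C 1)
    c₂ = + (t C 2)
    c₃ = + (t C 3)
    c₄ = + (t C 4)
    t≡ : c₁ ≡ + t
    t≡ = trans (sym (ℤ.*-identityˡ c₁)) (trans (C-falling t 0) (s (+ t)))
      where
      s : ∀ t → (t - 0ℤ) * 1ℤ ≡ t
      s = solve-∀
    next : ∀ n k x y → n * y ≡ (+ t - k) * x → + t * x ≡ n * y + k * x
    next n k x y eq = trans (s (+ t) k x) (cong (λ z → z + k * x) (sym eq))
      where
      s : ∀ t k x → t * x ≡ (t - k) * x + k * x
      s = solve-∀
    -- Powers in the binomial basis: tᵏ = Σ s! S(k, s) C(t, s) with Stirling numbers of the second
    -- kind. This is the origin of 2, 6, 14, 24 and 36 in `newtonCoeff`.
    t²≡ : + t * + t ≡ + 2 * c₂ + c₁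
    t²≡ = trans (cong (_*_ (+ t)) (sym t≡)) (trans (next (+ 2) 1ℤ c₁ c₂ (C-falling t 1))
      (cong (_+_ (+ 2 * c₂)) (ℤ.*-identityˡ c₁)))
    t³≡ : + t * + t * + t ≡ + 6 * c₃ + + 6 * c₂ + c₁
    t³≡ = trans (cong (_* + t) t²≡) (trans (s₁ (+ t) c₁ c₂)
      (trans (cong₂ (λ x y → + 2 * x + y) (next (+ 3) (+ 2) c₂ c₃ (C-falling t 2))
                                          (next (+ 2) 1ℤ c₁ c₂ (C-falling t 1)))
        (s₂ c₁ c₂ c₃)))
      where
      s₁ : ∀ t c₁ c₂ → (+ 2 * c₂ + c₁) * t ≡ + 2 * (t * c₂) + t * c₁
      s₁ = solve-∀
      s₂ : ∀ c₁ c₂ c₃ → + 2 * (+ 3 * c₃ + + 2 * c₂) + (+ 2 * c₂ + 1ℤ * c₁) ≡ + 6 * c₃ + + 6 * c₂ + c₁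
      s₂ = solve-∀
    t⁴≡ : + t * + t * + t * + t ≡ + 24 * c₄ + + 36 * c₃ + + 14 * c₂ + c₁
    t⁴≡ = trans (cong (_* + t) t³≡) (trans (s₁ (+ t) c₁ c₂ c₃)
      (trans (cong₂ _+_
          (cong₂ (λ x y → + 6 * x + + 6 * y) (next (+ 4) (+ 3) c₃ c₄ (C-falling t 3))
                                             (next (+ 3) (+ 2) c₂ c₃ (C-falling t 2)))
          (next (+ 2) 1ℤ c₁ c₂ (C-falling t 1)))
        (s₂ c₁ c₂ c₃ c₄)))
      where
      s₁ : ∀ t c₁ c₂ c₃ → (+ 6 * c₃ + + 6 * c₂ + c₁) * t ≡ + 6 * (t * c₃) + + 6 * (t * c₂) + t * c₁
      s₁ = solve-∀
      s₂ : ∀ c₁ c₂ c₃ c₄ → + 6 * (+ 4 * c₄ + + 3 * c₃) + + 6 * (+ 3 * c₃ + + 2 * c₂) + (+ 2 * c₂ + 1ℤ * c₁)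
        ≡ + 24 * c₄ + + 36 * c₃ + + 14 * c₂ + c₁
      s₂ = solve-∀
    T₁ T₂ T₃ T₄ T₅ : ℤ
    T₁ = 1ℤ * d 1 + (c₁ * d 2 + (c₂ * d 3 + (c₃ * d 4 + (c₄ * d 5 + 0ℤ))))
    T₂ = 1ℤ * d 2 + (c₁ * d 3 + (c₂ * d 4 + (c₃ * d 5 + 0ℤ)))
    T₃ = 1ℤ * d 3 + (c₁ * d 4 + (c₂ * d 5 + 0ℤ))
    T₄ = 1ℤ * d 4 + (c₁ * d 5 + 0ℤ)
    T₅ = 1ℤ * d 5 + (c₁ * d 6 + 0ℤ)
    truncations : (+ 5) ^ 7 S.∣ + 120 * (Δ b 1 t - T₁) - + 60 * (Δ b 2 t - T₂)
      + + 40 * (Δ b 3 t - T₃) - + 30 * (Δ b 4 t - T₄) + + 24 * (Δ b 5 t - T₅)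
    -- The coefficients 120, 60, 40 and 30 each bring a factor 5, so the differences of order r ≤ 4
    -- are needed only mod 5⁶, that is 6 - r terms. 24 brings none, so order 5 is needed mod 5⁷; its
    -- second term is the sole source of `d 6`, hence of E₂₄ and E₂₆.
    truncations =
      S.∣m∣n⇒∣m+n (S.∣m∣n⇒∣m-n (S.∣m∣n⇒∣m+n (S.∣m∣n⇒∣m-n
        (∣-* {+ 5} {(+ 5) ^ 6} (divides (+ 24) refl) (Δ-truncate b 1 5 t))
        (∣-* {+ 5} {(+ 5) ^ 6} (divides (+ 12) refl) (Δ-truncate b 2 4 t)))
        (∣-* {+ 5} {(+ 5) ^ 6} (divides (+ 8) refl) (Δ-truncate b 3 3 t)))
        (∣-* {+ 5} {(+ 5) ^ 6} (divides (+ 6) refl) (Δ-truncate b 4 2 t)))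
        (S.∣n⇒∣m*n (+ 24) (Δ-truncate b 5 2 t))
    A = newtonCoeff a₀ a₁ a₂ a₃ a₄ d
    coefficients : (+ 5) ^ 7 S.∣ A 0 + c₁ * A 1 + c₂ * A 2 + c₃ * A 3 + c₄ * A 4
    coefficients =
      S.∣m∣n⇒∣m+n (S.∣m∣n⇒∣m+n (S.∣m∣n⇒∣m+n (S.∣m∣n⇒∣m+n (h (# 0))
        (S.∣n⇒∣m*n c₁ (h (# 1)))) (S.∣n⇒∣m*n c₂ (h (# 2))))
        (S.∣n⇒∣m*n c₃ (h (# 3)))) (S.∣n⇒∣m*n c₄ (h (# 4)))
    combine : ∀ t c₁ c₂ c₃ c₄ a₀ a₁ a₂ a₃ a₄ d₁ d₂ d₃ d₄ d₅ d₆ D₁ D₂ D₃ D₄ D₅ →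
      c₁ ≡ t → t * t ≡ + 2 * c₂ + c₁ → t * t * t ≡ + 6 * c₃ + + 6 * c₂ + c₁ →
      t * t * t * t ≡ + 24 * c₄ + + 36 * c₃ + + 14 * c₂ + c₁ →
      + 120 * (D₁ - (1ℤ * d₁ + (c₁ * d₂ + (c₂ * d₃ + (c₃ * d₄ + (c₄ * d₅ + 0ℤ))))))
        - + 60 * (D₂ - (1ℤ * d₂ + (c₁ * d₃ + (c₂ * d₄ + (c₃ * d₅ + 0ℤ)))))
        + + 40 * (D₃ - (1ℤ * d₃ + (c₁ * d₄ + (c₂ * d₅ + 0ℤ))))
        - + 30 * (D₄ - (1ℤ * d₄ + (c₁ * d₅ + 0ℤ)))
        + + 24 * (D₅ - (1ℤ * d₅ + (c₁ * d₆ + 0ℤ)))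
        + ((+ 120 * d₁ - + 60 * d₂ + + 40 * d₃ - + 30 * d₄ + + 24 * d₅ - + 120 * a₀)
          + c₁ * (+ 120 * d₂ - + 60 * d₃ + + 40 * d₄ - + 30 * d₅ + + 24 * d₆ - + 120 * (a₁ + a₂ + a₃ + a₄))
          + c₂ * (+ 120 * d₃ - + 60 * d₄ + + 40 * d₅ - + 120 * (+ 2 * a₂ + + 6 * a₃ + + 14 * a₄))
          + c₃ * (+ 120 * d₄ - + 60 * d₅ - + 120 * (+ 6 * a₃ + + 36 * a₄))
          + c₄ * (+ 120 * d₅ - + 120 * (+ 24 * a₄)))
      ≡ + 120 * D₁ - + 60 * D₂ + + 40 * D₃ - + 30 * D₄ + + 24 * D₅
        - + 120 * (a₀ + a₁ * t + a₂ * (t * t) + a₃ * (t * t * t) + a₄ * (t * t * t * t))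
    combine t c₁ c₂ c₃ c₄ a₀ a₁ a₂ a₃ a₄ d₁ d₂ d₃ d₄ d₅ d₆ D₁ D₂ D₃ D₄ D₅ e₁ e₂ e₃ e₄
      -- Highest power first: t * t is a subterm of the longer products and would destroy them if
      -- rewritten earlier.
      rewrite e₄ | e₃ | e₂ | sym e₁ = s c₁ c₂ c₃ c₄ a₀ a₁ a₂ a₃ a₄ d₁ d₂ d₃ d₄ d₅ d₆ D₁ D₂ D₃ D₄ D₅
      where
      s : ∀ c₁ c₂ c₃ c₄ a₀ a₁ a₂ a₃ a₄ d₁ d₂ d₃ d₄ d₅ d₆ D₁ D₂ D₃ D₄ D₅ →
        + 120 * (D₁ - (1ℤ * d₁ + (c₁ * d₂ + (c₂ * d₃ + (c₃ * d₄ + (c₄ * d₅ + 0ℤ))))))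
        - + 60 * (D₂ - (1ℤ * d₂ + (c₁ * d₃ + (c₂ * d₄ + (c₃ * d₅ + 0ℤ)))))
        + + 40 * (D₃ - (1ℤ * d₃ + (c₁ * d₄ + (c₂ * d₅ + 0ℤ))))
        - + 30 * (D₄ - (1ℤ * d₄ + (c₁ * d₅ + 0ℤ)))
        + + 24 * (D₅ - (1ℤ * d₅ + (c₁ * d₆ + 0ℤ)))
        + ((+ 120 * d₁ - + 60 * d₂ + + 40 * d₃ - + 30 * d₄ + + 24 * d₅ - + 120 * a₀)
          + c₁ * (+ 120 * d₂ - + 60 * d₃ + + 40 * d₄ - + 30 * d₅ + + 24 * d₆ - + 120 * (a₁ + a₂ + a₃ + a₄))
          + c₂ * (+ 120 * d₃ - + 60 * d₄ + + 40 * d₅ - + 120 * (+ 2 * a₂ + + 6 * a₃ + + 14 * a₄))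
          + c₃ * (+ 120 * d₄ - + 60 * d₅ - + 120 * (+ 6 * a₃ + + 36 * a₄))
          + c₄ * (+ 120 * d₅ - + 120 * (+ 24 * a₄)))
        ≡ + 120 * D₁ - + 60 * D₂ + + 40 * D₃ - + 30 * D₄ + + 24 * D₅
        - + 120 * (a₀ + a₁ * c₁ + a₂ * (+ 2 * c₂ + c₁) + a₃ * (+ 6 * c₃ + + 6 * c₂ + c₁)
            + a₄ * (+ 24 * c₄ + + 36 * c₃ + + 14 * c₂ + c₁))
      s = solve-∀

-- Numerical values and the two polynomials

-- e₀ j = E₄ⱼ and e₂ j = E₄ⱼ₊₂ for j ≤ 6 only.
e₀ e₂ : Seq
e₀ 0 = + 1
e₀ 1 = + 5
e₀ 2 = + 1385
e₀ 3 = + 2702765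
e₀ 4 = + 19391512145
e₀ 5 = + 370371188237525
e₀ _ = + 15514534163557086905

e₂ 0 = - + 1
e₂ 1 = - + 61
e₂ 2 = - + 50521
e₂ 3 = - + 199360981
e₂ 4 = - + 2404879675441
e₂ 5 = - + 69348874393137901
e₂ _ = - + 4087072509293123892361

E≡e₀ : ∀ j → j ≤ 6 → E (j ℕ.* 4 ℕ.+ 0) ≡ e₀ j
E≡e₀ 0 _ = refl
E≡e₀ 1 _ = refl
E≡e₀ 2 _ = refl
E≡e₀ 3 _ = refl
E≡e₀ 4 _ = refl
E≡e₀ 5 _ = refl
E≡e₀ 6 _ = refl
E≡e₀ (suc (suc (suc (suc (suc (suc (suc _))))))) (s≤s (s≤s (s≤s (s≤s (s≤s (s≤s ()))))))

E≡e₂ : ∀ j → j ≤ 6 → E (j ℕ.* 4 ℕ.+ 2) ≡ e₂ j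
E≡e₂ 0 _ = refl
E≡e₂ 1 _ = refl
E≡e₂ 2 _ = refl
E≡e₂ 3 _ = refl
E≡e₂ 4 _ = refl
E≡e₂ 5 _ = refl
E≡e₂ 6 _ = refl
E≡e₂ (suc (suc (suc (suc (suc (suc (suc _))))))) (s≤s (s≤s (s≤s (s≤s (s≤s (s≤s ()))))))

Δ-values : ∀ b (e : Seq) → (∀ j → j ≤ 6 → E (j ℕ.* 4 ℕ.+ b) ≡ e j) → ∀ r → r ≤ 6 →
  Δ b r 0 ≡ W 1ℤ -1ℤ (λ j → e j - (+ 5) ^ (j ℕ.* 4 ℕ.+ b) * e j) r 0
Δ-values b e E≡e r r≤6 = W-cong≤ 1ℤ -1ℤ r 0 λ j j≤r →
  cong (λ x → x - (+ 5) ^ (j ℕ.* 4 ℕ.+ b) * x)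
    (E≡e j (ℕ.≤-trans j≤r (subst (_≤ 6) (sym (ℕ.+-identityʳ r)) r≤6)))

pos-4t+b : ∀ t b → + (t ℕ.* 4 ℕ.+ b) ≡ + t * + 4 + + b
pos-4t+b t b = cong (λ x → x + + b) (ℤ.pos-* t 4)

-- The five divisibilities are decided by evaluation. They are phrased through the table `e`, so
-- only literals are computed with; the recurrence for E is unfolded just in `E≡e₀` and `E≡e₂`.
logΔ-from-values : ∀ b (e : Seq) → (∀ j → j ≤ 6 → E (j ℕ.* 4 ℕ.+ b) ≡ e j) → ∀ a₀ a₁ a₂ a₃ a₄ →
  {_ : True (all? {5} λ s → (+ 5) ^ 7 ∣? newtonCoeff a₀ a₁ a₂ a₃ a₄
         (λ r → W 1ℤ -1ℤ (λ j → e j - (+ 5) ^ (j ℕ.* 4 ℕ.+ b) * e j) r 0) (toℕ s))} →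
  ∀ t → (+ 5) ^ 7 S.∣ logΔ b t
    - + 120 * (a₀ + a₁ * + t + a₂ * (+ t * + t) + a₃ * (+ t * + t * + t) + a₄ * (+ t * + t * + t * + t))
logΔ-from-values b e E≡e a₀ a₁ a₂ a₃ a₄ {computed} = logΔ-polynomial b a₀ a₁ a₂ a₃ a₄ λ s →
  subst ((+ 5) ^ 7 S.∣_) (sym (newtonCoeff-cong a₀ a₁ a₂ a₃ a₄ (Δ-values b e E≡e) (toℕ s)))
    (toWitness computed s)

log-at-0 : ∀ t b → b ≡ t ℕ.* 4 ℕ.+ 0 → (+ 5) ^ 7 S.∣ logΔ 0 t - + 120 *
  (+ 3130 - + 4000 * + b + + 3375 * (+ b) ^ 2 + + 3125 * (+ b) ^ 3 - + 3125 * (+ b) ^ 4)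
log-at-0 t b b≡ =
  subst (λ x → (+ 5) ^ 7 S.∣ logΔ 0 t - + 120 * x)
    (in-b (+ 3130) (+ 4000) (+ 3375) (+ 3125) (+ 3125) (+ t) (+ b) (trans (cong +_ b≡) (pos-4t+b t 0)))
    -- Coefficients in t after b = 4t: the one of bⁱ is multiplied by 4ⁱ.
    (logΔ-from-values 0 e₀ E≡e₀ (+ 3130) (- (+ 4 * + 4000)) (+ 16 * + 3375) (+ 64 * + 3125)
      (- (+ 256 * + 3125)) t)
  where
  in-t : ∀ q₀ q₁ q₂ q₃ q₄ t →
    q₀ + - (+ 4 * q₁) * t + + 16 * q₂ * (t * t) + + 64 * q₃ * (t * t * t)
      + - (+ 256 * q₄) * (t * t * t * t)
    ≡ q₀ - q₁ * (t * + 4 + 0ℤ) + q₂ * ((t * + 4 + 0ℤ) * ((t * + 4 + 0ℤ) * 1ℤ))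
      + q₃ * ((t * + 4 + 0ℤ) * ((t * + 4 + 0ℤ) * ((t * + 4 + 0ℤ) * 1ℤ)))
      - q₄ * ((t * + 4 + 0ℤ) * ((t * + 4 + 0ℤ) * ((t * + 4 + 0ℤ) * ((t * + 4 + 0ℤ) * 1ℤ))))
  in-t = solve-∀
  in-b : ∀ q₀ q₁ q₂ q₃ q₄ t b → b ≡ t * + 4 + + 0 →
    q₀ + - (+ 4 * q₁) * t + + 16 * q₂ * (t * t) + + 64 * q₃ * (t * t * t)
      + - (+ 256 * q₄) * (t * t * t * t)
    ≡ q₀ - q₁ * b + q₂ * b ^ 2 + q₃ * b ^ 3 - q₄ * b ^ 4
  in-b q₀ q₁ q₂ q₃ q₄ t b refl = in-t q₀ q₁ q₂ q₃ q₄ t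

log-at-2 : ∀ t b → b ≡ t ℕ.* 4 ℕ.+ 2 → (+ 5) ^ 7 S.∣ logΔ 2 t - + 120 *
  (+ 4790 + + 1750 * (+ b) ^ 2 + + 3125 * (+ b) ^ 3 + + 6250 * (+ b) ^ 4)
log-at-2 t b b≡ =
  subst (λ x → (+ 5) ^ 7 S.∣ logΔ 2 t - + 120 * x)
    (in-b (+ 4790) (+ 1750) (+ 3125) (+ 6250) (+ t) (+ b) (trans (cong +_ b≡) (pos-4t+b t 2)))
    -- Coefficients in t after b = 4t + 2, from the expansions of (4t + 2)², (4t + 2)³ and (4t +
    -- 2)⁴.
    (logΔ-from-values 2 e₂ E≡e₂ (+ 4790 + + 4 * + 1750 + + 8 * + 3125 + + 16 * + 6250)
      (+ 16 * + 1750 + + 48 * + 3125 + + 128 * + 6250)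
      (+ 16 * + 1750 + + 96 * + 3125 + + 384 * + 6250)
      (+ 64 * + 3125 + + 512 * + 6250) (+ 256 * + 6250) t)
  where
  in-t : ∀ q₀ q₂ q₃ q₄ t →
    q₀ + + 4 * q₂ + + 8 * q₃ + + 16 * q₄
      + (+ 16 * q₂ + + 48 * q₃ + + 128 * q₄) * t
      + (+ 16 * q₂ + + 96 * q₃ + + 384 * q₄) * (t * t)
      + (+ 64 * q₃ + + 512 * q₄) * (t * t * t)
      + + 256 * q₄ * (t * t * t * t)
    ≡ q₀ + q₂ * ((t * + 4 + + 2) * ((t * + 4 + + 2) * 1ℤ))
      + q₃ * ((t * + 4 + + 2) * ((t * + 4 + + 2) * ((t * + 4 + + 2) * 1ℤ)))
      + q₄ * ((t * + 4 + + 2) * ((t * + 4 + + 2) * ((t * + 4 + + 2) * ((t * + 4 + + 2) * 1ℤ))))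
  in-t = solve-∀
  in-b : ∀ q₀ q₂ q₃ q₄ t b → b ≡ t * + 4 + + 2 →
    q₀ + + 4 * q₂ + + 8 * q₃ + + 16 * q₄
      + (+ 16 * q₂ + + 48 * q₃ + + 128 * q₄) * t
      + (+ 16 * q₂ + + 96 * q₃ + + 384 * q₄) * (t * t)
      + (+ 64 * q₃ + + 512 * q₄) * (t * t * t)
      + + 256 * q₄ * (t * t * t * t)
    ≡ q₀ + q₂ * b ^ 2 + q₃ * b ^ 3 + q₄ * b ^ 4
  in-b q₀ q₂ q₃ q₄ t b refl = in-t q₀ q₂ q₃ q₄ t

-- From the regularised differences back to the Euler numbers

-- With a = m - 1 the right side is φ(5ᵐ), so the bound makes 5ⁿ Eₙ vanish mod 5ᵐ⁺⁵ for the index n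
-- = kφ(5ᵐ) + b.
a+6≤5^a*4 : ∀ a → 4 ≤ a → a ℕ.+ 6 ≤ 5 ℕ.^ a ℕ.* 4
a+6≤5^a*4 a 4≤a with ℕ.m≤n⇒∃[o]m+o≡n 4≤a
... | c , refl = go c
  where
  go : ∀ c → 4 ℕ.+ c ℕ.+ 6 ≤ 5 ℕ.^ (4 ℕ.+ c) ℕ.* 4
  go zero    = ℕ.m≤m+n 10 2490
  go (suc c) = ℕ.≤-trans (s≤s (go c)) (subst (suc (p ℕ.* 4) ≤_) (sym (ℕ.*-assoc 5 p 4))
    (ℕ.+-mono-≤ (ℕ.>-nonZero⁻¹ (p ℕ.* 4) {{ℕ.m*n≢0 p 4 {{ℕ.m^n≢0 5 (4 ℕ.+ c)}}}})
      (ℕ.m≤m+n (p ℕ.* 4) (3 ℕ.* (p ℕ.* 4)))))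
    where p = 5 ℕ.^ (4 ℕ.+ c)

-- Both ends of `E′-difference` carry an Euler factor. At the upper index its correction 5ⁿ Eₙ is
-- added back, being 0 to this modulus; at b it can be as large as a unit and remains as 1 - 5ᵇ.
E-congruence : ∀ b₀ k m t b P → 1 ≤ k → 5 ≤ m → b ≡ t ℕ.* 4 ℕ.+ b₀ →
  (+ 5) ^ 7 S.∣ logΔ b₀ t - + 120 * P →
  E (k ℕ.* φ (5 ℕ.^ m) ℕ.+ b) - (+ 1 - (+ 5) ^ b) * E b
  ≡ (+ 5) ^ (m ℕ.∸ 1) * + k * P [mod 5 ℕ.^ (m ℕ.+ 5) ]
E-congruence b k (suc a) t .(t ℕ.* 4 ℕ.+ b) P 1≤k (s≤s 4≤a) refl log≡P =
  S.∣⇒∣ᵤ {+ (5 ℕ.^ (suc a ℕ.+ 5))}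
    {E (k ℕ.* φ (5 ℕ.^ suc a) ℕ.+ c) - (+ 1 - (+ 5) ^ c) * E c - (+ 5) ^ a * + k * P}
    (subst₂ S._∣_ modulus regroup (S.∣m∣n⇒∣m+n (E′-difference b a k t P 4≤a log≡P) Euler-factor))
  where
  K = k ℕ.* 5 ℕ.^ a
  n = (K ℕ.+ t) ℕ.* 4 ℕ.+ b
  c = t ℕ.* 4 ℕ.+ b
  index : n ≡ k ℕ.* φ (5 ℕ.^ suc a) ℕ.+ c
  index = begin
    (K ℕ.+ t) ℕ.* 4 ℕ.+ b              ≡⟨ cong (ℕ._+ b) (ℕ.*-distribʳ-+ 4 K t) ⟩
    K ℕ.* 4 ℕ.+ t ℕ.* 4 ℕ.+ b          ≡⟨ ℕ.+-assoc (K ℕ.* 4) (t ℕ.* 4) b ⟩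
    K ℕ.* 4 ℕ.+ c                       ≡⟨ cong (ℕ._+ c) (ℕ.*-assoc k (5 ℕ.^ a) 4) ⟩
    k ℕ.* (5 ℕ.^ a ℕ.* 4) ℕ.+ c        ≡⟨ cong (λ x → k ℕ.* x ℕ.+ c) (φ-5^ a) ⟨
    k ℕ.* φ (5 ℕ.^ suc a) ℕ.+ c        ∎
    where open ≡-Reasoning
  modulus : (+ 5) ^ (a ℕ.+ 6) ≡ + (5 ℕ.^ (suc a ℕ.+ 5))
  modulus = trans (cong ((+ 5) ^_) (ℕ.+-suc a 5)) (sym (pos-5^ (suc a ℕ.+ 5)))
  Euler-factor : (+ 5) ^ (a ℕ.+ 6) S.∣ (+ 5) ^ n * E n
  Euler-factor = S.∣m⇒∣m*n (E n) (5^-≤-∣ (ℕ.≤-trans (a+6≤5^a*4 a 4≤a)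
    (subst (5 ℕ.^ a ℕ.* 4 ≤_) (sym index)
      (ℕ.≤-trans (subst (λ x → 5 ℕ.^ a ℕ.* 4 ≤ k ℕ.* x) (sym (φ-5^ a))
          (ℕ.m≤n*m (5 ℕ.^ a ℕ.* 4) k {{ℕ.>-nonZero 1≤k}}))
        (ℕ.m≤m+n (k ℕ.* φ (5 ℕ.^ suc a)) c)))))
  regroup : E′ b (K ℕ.+ t) - E′ b t - + K * P + (+ 5) ^ n * E n
    ≡ E (k ℕ.* φ (5 ℕ.^ suc a) ℕ.+ c) - (+ 1 - (+ 5) ^ c) * E c - (+ 5) ^ a * + k * P
  regroup = begin
    E n - (+ 5) ^ n * E n - (E c - (+ 5) ^ c * E c) - + K * P + (+ 5) ^ n * E n
      ≡⟨ cong (λ x → E n - (+ 5) ^ n * E n - (E c - (+ 5) ^ c * E c) - x * P + (+ 5) ^ n * E n)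
           (trans (ℤ.pos-* k (5 ℕ.^ a)) (cong (_*_ (+ k)) (pos-5^ a))) ⟩
    E n - (+ 5) ^ n * E n - (E c - (+ 5) ^ c * E c) - + k * (+ 5) ^ a * P + (+ 5) ^ n * E n
      ≡⟨ lemma (E n) (E c) ((+ 5) ^ n) ((+ 5) ^ c) ((+ 5) ^ a) (+ k) P ⟩
    E n - (+ 1 - (+ 5) ^ c) * E c - (+ 5) ^ a * + k * P
      ≡⟨ cong (λ i → E i - (+ 1 - (+ 5) ^ c) * E c - (+ 5) ^ a * + k * P) index ⟩
    E (k ℕ.* φ (5 ℕ.^ suc a) ℕ.+ c) - (+ 1 - (+ 5) ^ c) * E c - (+ 5) ^ a * + k * P ∎
    where
    open ≡-Reasoning
    lemma : ∀ x y p q r k P → x - p * x - (y - q * y) - k * r * P + p * x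
      ≡ x - (+ 1 - q) * y - r * k * P
    lemma = solve-∀

≡2[mod4]⇒ : ∀ b → + b ≡ + 2 [mod 4 ] → ∃ λ t → b ≡ t ℕ.* 4 ℕ.+ 2
≡2[mod4]⇒ 0             4∣2 = contradiction 4∣2 (ℕ.>⇒∤ (ℕ.m≤m+n 3 1))
≡2[mod4]⇒ 1             4∣1 = contradiction 4∣1 (ℕ.>⇒∤ (ℕ.m≤m+n 2 2))
≡2[mod4]⇒ (suc (suc b)) (ℕ.divides t eq) = t , trans (ℕ.+-comm 2 b) (cong (ℕ._+ 2) eq)

≡0[mod4]⇒ : ∀ b → + b ≡ + 0 [mod 4 ] → ∃ λ t → b ≡ t ℕ.* 4 ℕ.+ 0
≡0[mod4]⇒ b (ℕ.divides t eq) = t , trans (sym (ℕ.+-identityʳ b)) (trans eq (sym (ℕ.+-identityʳ _)))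

theorem4p1 : (k m : ℕ) → 1 ≤ k → 5 ≤ m → (b : ℕ) → 2 ∣ b →
    ((+ b ≡ + 0 [mod 4 ] →
    E (k ℕ.* φ (5 ℕ.^ m) ℕ.+ b) - (+ 1 - (+ 5) ^ b) * E b
    ≡ (+ 5) ^ (m ℕ.∸ 1) * + k
    * (+ 3130 - + 4000 * + b + + 3375 * (+ b) ^ 2 + + 3125 * (+ b) ^ 3 - + 3125 * (+ b) ^ 4)
    [mod 5 ℕ.^ (m ℕ.+ 5) ])
    × (+ b ≡ + 2 [mod 4 ] →
    E (k ℕ.* φ (5 ℕ.^ m) ℕ.+ b) - (+ 1 - (+ 5) ^ b) * E b
    ≡ (+ 5) ^ (m ℕ.∸ 1) * + k
    * (+ 4790 + + 1750 * (+ b) ^ 2 + + 3125 * (+ b) ^ 3 + + 6250 * (+ b) ^ 4)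
    [mod 5 ℕ.^ (m ℕ.+ 5) ]))
theorem4p1 k m 1≤k 5≤m b _ =
  (λ b≡0 → let t , b≡ = ≡0[mod4]⇒ b b≡0 in
    E-congruence 0 k m t b
      (+ 3130 - + 4000 * + b + + 3375 * (+ b) ^ 2 + + 3125 * (+ b) ^ 3 - + 3125 * (+ b) ^ 4)
      1≤k 5≤m b≡ (log-at-0 t b b≡)) ,
  (λ b≡2 → let t , b≡ = ≡2[mod4]⇒ b b≡2 in
    E-congruence 2 k m t b
      (+ 4790 + + 1750 * (+ b) ^ 2 + + 3125 * (+ b) ^ 3 + + 6250 * (+ b) ^ 4)
      1≤k 5≤m b≡ (log-at-2 t b b≡))
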